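{- For positive integers $n$ and $r$, let $s=(2r,3r,\ldots,nr)$ and $\mu=(r,2r,\ldots,nr)$. Then \[ d_{n-1}^s(z)+d_n^\mu(z)=d_{n,r}(z). \]
   Context: For a sequence $t=(t_1,\ldots,t_m)$ of positive integers, $P_m^t=\{x\in\mathbb{R}^m:0\le x_1/t_1\le\cdots\le x_m/t_m\le1\}$ (for $m=0$ a point) and $d_m^t(z)=\ell^\ast(P_m^t;z)$, where for a lattice $d$-simplex $\Delta=\mathrm{conv}(v^{(0)},\ldots,v^{(d)})\subset\mathbb{R}^m$, $\ell^\ast(\Delta;z)=\sum_{x\in\Pi^\circ_\Delta\cap\mathbb{Z}^{m+1}}z^{x_{m+1}}$, $\Pi^\circ_\Delta=\{\sum_i\lambda_i(v^{(i)},1):0<\lambda_i<1\}$. An $r$-colored permutation is $(\pi,c)$ with $\pi\in\mathfrak{S}_n$, $c\in\{0,\ldots,r-1\}^n$. An index $i$ is an excedance if $\pi_i>i$, or $\pi_i=i$ and $c_i>0$. A derangement is one with no fixed point of color $0$; $d_{n,r}(z)=\sum_{\sigma}z^{\mathrm{exc}(\sigma)}$ over all $r$-colored derangements of length $n$. -}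

module Defs where

open import Data.Bool.Base using (if_then_else_)
open import Data.Fin.Base as Fin using (Fin; zero; suc; toℕ)
import Data.Fin.Properties as Fin
open import Data.Integer.Base as ℤ using (ℤ; +_; 0ℤ; ∣_∣)
import Data.Integer.Properties as ℤ
open import Data.List.Base as List using (List; []; _∷_; _++_; [_])
open import Data.List.Membership.Propositional using (_∈_)
open import Data.List.Membership.Propositional.Properties
  using (∈-filter⁺; ∈-filter⁻; ∈-cartesianProductWith⁺; ∈-cartesianProduct⁺;
         ∈-map⁺; ∈-upTo⁺; ∈-allFin)
open import Data.List.Relation.Unary.All using ([])
open import Data.List.Relation.Unary.AllPairs using ([]; _∷_)
open import Data.List.Relation.Unary.Any using (here)
open import Data.List.Relation.Unary.Linked using (Linked; [-]; _∷_)
open import Data.List.Relation.Unary.Unique.Propositional using (Unique)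
import Data.List.Relation.Unary.Unique.Propositional.Properties as Unique
open import Data.Nat.Base as ℕ using (ℕ; zero; suc; NonZero)
import Data.Nat.Properties as ℕ
open import Data.Product.Base using (∃; _×_; _,_; proj₁; proj₂)
open import Data.Rational.Base as ℚ
  using (ℚ; 0ℚ; 1ℚ; _+_; _-_; -_; _*_; _÷_; _≤_; _<_; *≤*)
open import Data.Rational.Literals using (fromℤ)
import Data.Rational.Properties as ℚ
import Data.Rational.Solver as ℚ
import Data.Rational.Unnormalised.Base as ℚᵘ
import Data.Rational.Unnormalised.Properties as ℚᵘ
open import Data.Sum.Base using (_⊎_)
open import Data.Vec.Base as Vec using (Vec; []; _∷_; lookup)
import Data.Vec.Properties as Vec
open import Data.Vec.Functional using (Vector)
open import Function.Base using (_∘_; const)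
open import Function.Definitions using (Injective; Surjective; Bijective)
open import Relation.Binary.PropositionalEquality
  using (_≡_; refl; sym; trans; cong; cong₂; subst; subst₂; module ≡-Reasoning)
open import Relation.Nullary.Decidable
  using (Dec; yes; no; map′; ¬?; _×-dec_; _⊎-dec_; _→-dec_)
open import Relation.Nullary.Negation using (¬_; contradiction)
open import Relation.Unary using (Pred; Decidable; _≐_)
open import Level using (0ℓ)

open import Algebra.Properties.CommutativeMonoid.Sum ℚ.+-0-commutativeMonoid
  using (sum; sum-syntax; sum-cong-≗; sum-replicate-zero)

-- Coefficient lists, constant term first; trailing zeros are allowed, so
-- the equality of polynomials is _≋_.
Poly : Set
Poly = List ℕ

coeff : Poly → ℕ → ℕ
coeff []      _       = 0
coeff (a ∷ p) zero    = a
coeff (a ∷ p) (suc k) = coeff p k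

infix 4 _≋_
_≋_ : Poly → Poly → Set
p ≋ q = ∀ k → coeff p k ≡ coeff q k

infixl 6 _+ₚ_
_+ₚ_ : Poly → Poly → Poly
[]      +ₚ q       = q
(a ∷ p) +ₚ []      = a ∷ p
(a ∷ p) +ₚ (b ∷ q) = a ℕ.+ b ∷ p +ₚ q

z^_ : ℕ → Poly
z^ k = List.replicate k 0 ++ [ 1 ]

record Enumeration {A : Set} (P : Pred A 0ℓ) : Set where
  field
    elements : List A
    unique   : Unique elements
    sound    : ∀ {x} → x ∈ elements → P x
    complete : ∀ {x} → P x → x ∈ elements

-- Σ_{x ∈ P} z^{w(x)}.  Two enumerations of P are permutations of each
-- other, so the polynomial depends on P and w only.
generatingPoly : ∀ {A : Set} {P : Pred A 0ℓ} → (w : A → ℕ) → Enumeration P → Poly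
generatingPoly w E =
  List.foldr _+ₚ_ [] (List.map (λ x → z^ (w x)) (Enumeration.elements E))

filterEnumeration : ∀ {A : Set} {P : Pred A 0ℓ} → Decidable P →
                    (xs : List A) → Unique xs → (∀ {x} → P x → x ∈ xs) →
                    Enumeration P
filterEnumeration P? xs xs! P⊆xs = record
  { elements = List.filter P? xs
  ; unique   = Unique.filter⁺ P? xs!
  ; sound    = proj₂ ∘ ∈-filter⁻ P? {xs = xs}
  ; complete = λ Px → ∈-filter⁺ P? (P⊆xs Px) Px
  }

allVecs : ∀ {A : Set} {m} → Vector (List A) m → List (Vec A m)
allVecs {m = zero}  L = [ [] ]
allVecs {m = suc m} L =
  List.cartesianProductWith _∷_ (L zero) (allVecs (L ∘ suc))

allVecs-unique : ∀ {A : Set} {m} (L : Vector (List A) m) →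
                 (∀ j → Unique (L j)) → Unique (allVecs L)
allVecs-unique {m = zero}  L L! = [] ∷ []
allVecs-unique {m = suc m} L L! =
  Unique.cartesianProductWith⁺ _∷_ Vec.∷-injective (L! zero)
    (allVecs-unique (L ∘ suc) (L! ∘ suc))

∈-allVecs : ∀ {A : Set} {m} (L : Vector (List A) m) (v : Vec A m) →
            (∀ j → lookup v j ∈ L j) → v ∈ allVecs L
∈-allVecs L []      v∈L = here refl
∈-allVecs L (x ∷ v) v∈L =
  ∈-cartesianProductWith⁺ _∷_ (v∈L zero) (∈-allVecs (L ∘ suc) v (v∈L ∘ suc))

-- Σᵢ λᵢ (vᵢ , 1) = (p , h).  Rational numbers stand in for the reals; nothing
-- is lost for the lattice points of Π°, since the coordinates of a lattice
-- point with respect to linearly independent integer vectors (vᵢ , 1) are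
-- rational.
IsCombination : ∀ {k m} → Vector ℚ k → Vector (Vector ℤ m) k →
                Vector ℚ m → ℚ → Set
IsCombination {k} λs v p h =
  (∀ j → ∑[ i < k ] (λs i * fromℤ (v i j)) ≡ p j) × (∑[ i < k ] λs i ≡ h)

conv : ∀ {k m} → Vector (Vector ℤ m) k → Pred (Vector ℚ m) 0ℓ
conv v p = ∃ λ λs → (∀ i → 0ℚ ≤ λs i) × IsCombination λs v p 1ℚ

AffinelyIndependent : ∀ {k m} → Vector (Vector ℤ m) k → Set
AffinelyIndependent v =
  ∀ λs → IsCombination λs v (const 0ℚ) 0ℚ → ∀ i → λs i ≡ 0ℚ

record IsLatticeSimplex {m} (d : ℕ) (Δ : Pred (Vector ℚ m) 0ℓ) : Set where
  field
    vertices    : Vector (Vector ℤ m) (suc d)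
    independent : AffinelyIndependent vertices
    hull        : Δ ≐ conv vertices

-- The lattice points of the open parallelepiped Π°, with ℤ^{m+1} written as
-- ℤ^m × ℤ.
Π° : ∀ {m d} {Δ : Pred (Vector ℚ m) 0ℓ} → IsLatticeSimplex d Δ →
     Pred (Vec ℤ m × ℤ) 0ℓ
Π° S (x , h) = ∃ λ λs → (∀ i → 0ℚ < λs i × λs i < 1ℚ) ×
  IsCombination λs (IsLatticeSimplex.vertices S) (fromℤ ∘ lookup x) (fromℤ h)

-- On Π° the last coordinate h is a sum of positive numbers, hence ∣ h ∣ is h.
ℓ* : ∀ {m d} {Δ : Pred (Vector ℚ m) 0ℓ} (S : IsLatticeSimplex d Δ) →
     Enumeration (Π° S) → Poly
ℓ* S = generatingPoly (∣_∣ ∘ proj₂)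

-- λ₀ + … + λⱼ
partial : ∀ {m} → Vector ℚ (suc m) → Fin m → ℚ
partial λs zero    = λs zero
partial λs (suc j) = λs zero + partial (λs ∘ suc) j

-- the successive differences of a, y₀, …, y₍ₘ₋₁₎, h
gaps : ∀ {m} → ℚ → Vector ℚ m → ℚ → Vector ℚ (suc m)
gaps {zero}  a y h _       = h - a
gaps {suc m} a y h zero    = y zero - a
gaps {suc m} a y h (suc i) = gaps (y zero) (y ∘ suc) h i

a+[b-a]≡b : ∀ a b → a + (b - a) ≡ b
a+[b-a]≡b = solve 2 (λ a b → a :+ (b :- a) := b) refl
  where open ℚ.+-*-Solver

[a+b]-a≡b : ∀ a b → (a + b) - a ≡ b
[a+b]-a≡b = solve 2 (λ a b → (a :+ b) :- a := b) refl
  where open ℚ.+-*-Solver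

shift : ∀ a b c → a + ((b - a) + c) ≡ b + c
shift = solve 3 (λ a b c → a :+ ((b :- a) :+ c) := b :+ c) refl
  where open ℚ.+-*-Solver

partial-gaps : ∀ {m} a (y : Vector ℚ m) h j → a + partial (gaps a y h) j ≡ y j
partial-gaps a y h zero    = a+[b-a]≡b a (y zero)
partial-gaps a y h (suc j) =
  trans (shift a (y zero) _) (partial-gaps (y zero) (y ∘ suc) h j)

sum-gaps : ∀ {m} a (y : Vector ℚ m) h → a + sum (gaps a y h) ≡ h
sum-gaps {zero}  a y h = trans (cong (λ x → a + x) (ℚ.+-identityʳ _)) (a+[b-a]≡b a h)
sum-gaps {suc m} a y h =
  trans (shift a (y zero) _) (sum-gaps (y zero) (y ∘ suc) h)

step : ∀ a l x {y b} → a + l ≡ y → a + (l + x) ≡ b → y + x ≡ b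
step a l x p q = trans (cong (_+ x) (sym p)) (trans (ℚ.+-assoc a l x) q)

gaps-unique : ∀ {m} a (y : Vector ℚ m) h λs →
              (∀ j → a + partial λs j ≡ y j) → a + sum λs ≡ h →
              ∀ i → λs i ≡ gaps a y h i
gaps-unique {zero} a y h λs p s zero =
  trans (sym ([a+b]-a≡b a (λs zero)))
        (cong (_- a) (trans (cong (λ x → a + x) (sym (ℚ.+-identityʳ _))) s))
gaps-unique {suc m} a y h λs p s zero =
  trans (sym ([a+b]-a≡b a (λs zero))) (cong (_- a) (p zero))
gaps-unique {suc m} a y h λs p s (suc i) =
  gaps-unique (y zero) (y ∘ suc) h (λs ∘ suc)
    (λ j → step a (λs zero) _ (p zero) (p (suc j))) (step a (λs zero) _ (p zero) s) i

a≤a+l : ∀ a {l} → 0ℚ ≤ l → a ≤ a + l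
a≤a+l a 0≤l = subst (_≤ a + _) (ℚ.+-identityʳ a) (ℚ.+-monoʳ-≤ a 0≤l)

chain : ∀ {m} a (y : Vector ℚ m) h λs → (∀ i → 0ℚ ≤ λs i) →
        (∀ j → a + partial λs j ≡ y j) → a + sum λs ≡ h →
        Linked _≤_ (a ∷ List.tabulate y ++ [ h ])
chain {zero} a y h λs 0≤λ p s =
  subst (a ≤_) (trans (cong (λ x → a + x) (sym (ℚ.+-identityʳ _))) s) (a≤a+l a (0≤λ zero)) ∷ [-]
chain {suc m} a y h λs 0≤λ p s =
  subst (a ≤_) (p zero) (a≤a+l a (0≤λ zero)) ∷
  chain (y zero) (y ∘ suc) h (λs ∘ suc) (0≤λ ∘ suc)
    (λ j → step a (λs zero) _ (p zero) (p (suc j))) (step a (λs zero) _ (p zero) s)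

0≤b-a : ∀ {a b} → a ≤ b → 0ℚ ≤ b - a
0≤b-a {a} {b} a≤b = subst (_≤ b - a) (ℚ.+-inverseʳ a) (ℚ.+-monoˡ-≤ (- a) a≤b)

gaps-nonNeg : ∀ {m} a (y : Vector ℚ m) h →
              Linked _≤_ (a ∷ List.tabulate y ++ [ h ]) →
              ∀ i → 0ℚ ≤ gaps a y h i
gaps-nonNeg {zero}  a y h (a≤h ∷ _) zero    = 0≤b-a a≤h
gaps-nonNeg {suc m} a y h (a≤y ∷ _) zero    = 0≤b-a a≤y
gaps-nonNeg {suc m} a y h (_ ∷ c)   (suc i) =
  gaps-nonNeg (y zero) (y ∘ suc) h c i

fromℕ : ℕ → ℚ
fromℕ n = fromℤ (+ n)

fromℤ-* : ∀ a b → fromℤ a * fromℤ b ≡ fromℤ (a ℤ.* b)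
fromℤ-* a b = ℚ.toℚᵘ-injective
  (ℚᵘ.≃-trans (ℚ.toℚᵘ-homo-* (fromℤ a) (fromℤ b)) (ℚᵘ.*≡* refl))

fromℕ-suc : ∀ n → 1ℚ + fromℕ n ≡ fromℕ (suc n)
fromℕ-suc n = ℚ.toℚᵘ-injective (ℚᵘ.≃-trans (ℚ.toℚᵘ-homo-+ 1ℚ (fromℕ n))
  (ℚᵘ.*≡* (cong (λ x → (+ 1 ℤ.+ x) ℤ.* + 1) (ℤ.*-identityʳ (+ n)))))

fromℤ-cancel-≤ : ∀ {a b} → fromℤ a ≤ fromℤ b → a ℤ.≤ b
fromℤ-cancel-≤ (*≤* a≤b) = subst₂ ℤ._≤_ (ℤ.*-identityʳ _) (ℤ.*-identityʳ _) a≤b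

0≤fromℕ : ∀ n → 0ℚ ≤ fromℕ n
0≤fromℕ n = ℚ.nonNegative⁻¹ (fromℕ n)

bounded-≤ : ∀ {l x n} → l ≤ 1ℚ → x ≤ fromℕ n → l + x ≤ fromℕ (suc n)
bounded-≤ {n = n} l≤1 x≤n = subst (_ ≤_) (fromℕ-suc n) (ℚ.+-mono-≤ l≤1 x≤n)

0≤partial : ∀ {m} (λs : Vector ℚ (suc m)) → (∀ i → 0ℚ ≤ λs i) →
            ∀ j → 0ℚ ≤ partial λs j
0≤partial λs 0≤λ zero    = 0≤λ zero
0≤partial λs 0≤λ (suc j) = ℚ.+-mono-≤ (0≤λ zero) (0≤partial (λs ∘ suc) (0≤λ ∘ suc) j)

partial≤ : ∀ {m} (λs : Vector ℚ (suc m)) → (∀ i → λs i ≤ 1ℚ) →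
           ∀ j → partial λs j ≤ fromℕ (suc m)
partial≤ λs λ≤1 zero    =
  subst (_≤ _) (ℚ.+-identityʳ _) (bounded-≤ (λ≤1 zero) (0≤fromℕ _))
partial≤ λs λ≤1 (suc j) = bounded-≤ (λ≤1 zero) (partial≤ (λs ∘ suc) (λ≤1 ∘ suc) j)

0≤sum : ∀ {m} (λs : Vector ℚ m) → (∀ i → 0ℚ ≤ λs i) → 0ℚ ≤ sum λs
0≤sum {zero}  λs 0≤λ = ℚ.≤-refl
0≤sum {suc m} λs 0≤λ = ℚ.+-mono-≤ (0≤λ zero) (0≤sum (λs ∘ suc) (0≤λ ∘ suc))

sum≤ : ∀ {m} (λs : Vector ℚ m) → (∀ i → λs i ≤ 1ℚ) → sum λs ≤ fromℕ m
sum≤ {zero}  λs λ≤1 = ℚ.≤-refl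
sum≤ {suc m} λs λ≤1 = bounded-≤ (λ≤1 zero) (sum≤ (λs ∘ suc) (λ≤1 ∘ suc))

range : ℕ → List ℤ
range b = List.map +_ (List.upTo (suc b))

range-unique : ∀ b → Unique (range b)
range-unique b = Unique.map⁺ ℤ.+-injective (Unique.upTo⁺ (suc b))

∈-range : ∀ {x b} → 0ℚ ≤ fromℤ x → fromℤ x ≤ fromℕ b → x ∈ range b
∈-range 0≤x x≤b with fromℤ-cancel-≤ 0≤x | fromℤ-cancel-≤ x≤b
... | ℤ.+≤+ _ | ℤ.+≤+ n≤b = ∈-map⁺ +_ (∈-upTo⁺ (ℕ.s≤s n≤b))

module LectureHall {m : ℕ} (t : Vector ℕ m) (t>0 : ∀ j → NonZero (t j)) where

  _/t : Vector ℚ m → Vector ℚ m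
  (x /t) j = (x j ÷ fromℤ (+ t j)) {{t>0 j}}

  -- 0 ≤ x₁/t₁ ≤ … ≤ x_m/t_m ≤ 1
  P : Pred (Vector ℚ m) 0ℓ
  P x = Linked _≤_ (0ℚ ∷ List.tabulate (x /t) ++ [ 1ℚ ])

  -- v⁽ⁱ⁾ = (0, …, 0, t_{i+1}, …, t_m) with i leading zeros
  vertex : Vector (Vector ℤ m) (suc m)
  vertex i j = if toℕ i ℕ.≤ᵇ toℕ j then + t j else 0ℤ

  ≤ᵇ-suc : ∀ a b → (suc a ℕ.≤ᵇ suc b) ≡ (a ℕ.≤ᵇ b)
  ≤ᵇ-suc zero    b = refl
  ≤ᵇ-suc (suc a) b = refl

  sum-vertex : ∀ {n} (λs : Vector ℚ (suc n)) (T : ℤ) (j : Fin n) →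
    ∑[ i < suc n ] (λs i * fromℤ (if toℕ i ℕ.≤ᵇ toℕ j then T else 0ℤ)) ≡
    fromℤ T * partial λs j
  sum-vertex {suc n} λs T zero = begin
    λs zero * fromℤ T + ∑[ i < suc n ] (λs (suc i) * 0ℚ)
      ≡⟨ cong (λ x → λs zero * fromℤ T + x) (sum-cong-≗ (λ i → ℚ.*-zeroʳ (λs (suc i)))) ⟩
    λs zero * fromℤ T + sum {suc n} (const 0ℚ)
      ≡⟨ cong (λ x → λs zero * fromℤ T + x) (sum-replicate-zero (suc n)) ⟩
    λs zero * fromℤ T + 0ℚ
      ≡⟨ ℚ.+-identityʳ _ ⟩
    λs zero * fromℤ T
      ≡⟨ ℚ.*-comm (λs zero) (fromℤ T) ⟩
    fromℤ T * λs zero ∎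
    where open ≡-Reasoning
  sum-vertex {suc n} λs T (suc j) = begin
    λs zero * fromℤ T + ∑[ i < suc n ]
      (λs (suc i) * fromℤ (if suc (toℕ i) ℕ.≤ᵇ suc (toℕ j) then T else 0ℤ))
      ≡⟨ cong₂ _+_ (ℚ.*-comm (λs zero) (fromℤ T))
           (sum-cong-≗ (λ i → cong (λ b → λs (suc i) * fromℤ (if b then T else 0ℤ))
                                    (≤ᵇ-suc (toℕ i) (toℕ j)))) ⟩
    fromℤ T * λs zero + ∑[ i < suc n ]
      (λs (suc i) * fromℤ (if toℕ i ℕ.≤ᵇ toℕ j then T else 0ℤ))
      ≡⟨ cong (λ x → fromℤ T * λs zero + x) (sum-vertex (λs ∘ suc) T j) ⟩
    fromℤ T * λs zero + fromℤ T * partial (λs ∘ suc) j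
      ≡⟨ ℚ.*-distribˡ-+ (fromℤ T) (λs zero) (partial (λs ∘ suc) j) ⟨
    fromℤ T * (λs zero + partial (λs ∘ suc) j) ∎
    where open ≡-Reasoning

  ÷-cancel : ∀ x T .{{_ : ℚ.NonZero T}} → T * (x ÷ T) ≡ x
  ÷-cancel x T = begin
    T * (x * ℚ.1/ T)  ≡⟨ ℚ.*-comm T _ ⟩
    x * ℚ.1/ T * T    ≡⟨ ℚ.*-assoc x _ T ⟩
    x * (ℚ.1/ T * T)  ≡⟨ cong (λ y → x * y) (ℚ.*-inverseˡ T) ⟩
    x * 1ℚ            ≡⟨ ℚ.*-identityʳ x ⟩
    x                 ∎
    where open ≡-Reasoning

  *-÷-cancel : ∀ x T .{{_ : ℚ.NonZero T}} → (T * x) ÷ T ≡ x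
  *-÷-cancel x T = begin
    T * x * ℚ.1/ T    ≡⟨ cong (_* ℚ.1/ T) (ℚ.*-comm T x) ⟩
    x * T * ℚ.1/ T    ≡⟨ ℚ.*-assoc x T _ ⟩
    x * (T * ℚ.1/ T)  ≡⟨ cong (λ y → x * y) (ℚ.*-inverseʳ T) ⟩
    x * 1ℚ            ≡⟨ ℚ.*-identityʳ x ⟩
    x                 ∎
    where open ≡-Reasoning

  combination⇒partial : ∀ λs x h → IsCombination λs vertex x h →
                        ∀ j → 0ℚ + partial λs j ≡ (x /t) j
  combination⇒partial λs x h (c , _) j = begin
    0ℚ + partial λs j
      ≡⟨ ℚ.+-identityˡ _ ⟩
    partial λs j
      ≡⟨ *-÷-cancel (partial λs j) (fromℤ (+ t j)) {{t>0 j}} ⟨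
    ((fromℤ (+ t j) * partial λs j) ÷ fromℤ (+ t j)) {{t>0 j}}
      ≡⟨ cong (λ y → (y ÷ fromℤ (+ t j)) {{t>0 j}})
              (trans (sym (sum-vertex λs (+ t j) j)) (c j)) ⟩
    (x /t) j ∎
    where open ≡-Reasoning

  combination⇒sum : ∀ λs x h → IsCombination λs vertex x h → 0ℚ + sum λs ≡ h
  combination⇒sum λs x h (_ , s) = trans (ℚ.+-identityˡ _) s

  combination⇒gaps : ∀ λs x h → IsCombination λs vertex x h →
                     ∀ i → λs i ≡ gaps 0ℚ (x /t) h i
  combination⇒gaps λs x h c =
    gaps-unique 0ℚ (x /t) h λs (combination⇒partial λs x h c) (combination⇒sum λs x h c)

  gaps-combination : ∀ x h → IsCombination (gaps 0ℚ (x /t) h) vertex x h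
  gaps-combination x h =
    (λ j → trans (sum-vertex (gaps 0ℚ (x /t) h) (+ t j) j)
      (trans (cong (λ y → fromℤ (+ t j) * y)
               (trans (sym (ℚ.+-identityˡ (partial (gaps 0ℚ (x /t) h) j))) (partial-gaps 0ℚ (x /t) h j)))
             (÷-cancel (x j) (fromℤ (+ t j)) {{t>0 j}})))
    , trans (sym (ℚ.+-identityˡ (sum (gaps 0ℚ (x /t) h)))) (sum-gaps 0ℚ (x /t) h)

  zero-combination : IsCombination (const 0ℚ) vertex (const 0ℚ) 0ℚ
  zero-combination =
    (λ j → trans (sum-cong-≗ {suc m} (λ i → ℚ.*-zeroˡ (fromℤ (vertex i j))))
                 (sum-replicate-zero (suc m)))
    , sum-replicate-zero (suc m)

  isLatticeSimplex : IsLatticeSimplex m P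
  isLatticeSimplex = record
    { vertices    = vertex
    ; independent = λ λs c i →
        trans (combination⇒gaps λs (const 0ℚ) 0ℚ c i)
              (sym (combination⇒gaps (const 0ℚ) (const 0ℚ) 0ℚ zero-combination i))
    ; hull        =
        (λ {x} x∈P → gaps 0ℚ (x /t) 1ℚ , gaps-nonNeg 0ℚ (x /t) 1ℚ x∈P
                   , gaps-combination x 1ℚ) ,
        (λ {x} (λs , 0≤λ , c) → chain 0ℚ (x /t) 1ℚ λs 0≤λ
                   (combination⇒partial λs x 1ℚ c) (combination⇒sum λs x 1ℚ c))
    }

  Π°? : Decidable (Π° isLatticeSimplex)
  Π°? (x , h) = map′
    (λ 0<g<1 → _ , 0<g<1 , gaps-combination (fromℤ ∘ lookup x) (fromℤ h))
    (λ (λs , 0<λ<1 , c) i →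
      subst (λ l → 0ℚ < l × l < 1ℚ) (combination⇒gaps λs X H c i) (0<λ<1 i))
    (Fin.all? (λ i → (0ℚ ℚ.<? gaps 0ℚ (X /t) H i) ×-dec
                     (gaps 0ℚ (X /t) H i ℚ.<? 1ℚ)))
    where
    X = fromℤ ∘ lookup x
    H = fromℤ h

  ranges : Vector (List ℤ) m
  ranges j = range (t j ℕ.* suc m)

  box : List (Vec ℤ m × ℤ)
  box = List.cartesianProduct (allVecs ranges) (range (suc m))

  Π°⊆box : ∀ {x} → Π° isLatticeSimplex x → x ∈ box
  Π°⊆box {x , h} (λs , 0<λ<1 , c , s) = ∈-cartesianProduct⁺
    (∈-allVecs ranges x (λ j → ∈-range (0≤x j) (x≤b j)))
    (∈-range (subst (0ℚ ≤_) s (0≤sum λs 0≤λ)) (subst (_≤ _) s (sum≤ λs λ≤1)))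
    where
    0≤λ : ∀ i → 0ℚ ≤ λs i
    0≤λ i = ℚ.<⇒≤ (proj₁ (0<λ<1 i))

    λ≤1 : ∀ i → λs i ≤ 1ℚ
    λ≤1 i = ℚ.<⇒≤ (proj₂ (0<λ<1 i))

    x≡ : ∀ j → fromℕ (t j) * partial λs j ≡ fromℤ (lookup x j)
    x≡ j = trans (sym (sum-vertex λs (+ t j) j)) (c j)

    0≤x : ∀ j → 0ℚ ≤ fromℤ (lookup x j)
    0≤x j = subst₂ _≤_ (ℚ.*-zeroʳ (fromℕ (t j))) (x≡ j)
      (ℚ.*-monoˡ-≤-nonNeg (fromℕ (t j)) (0≤partial λs 0≤λ j))

    x≤b : ∀ j → fromℤ (lookup x j) ≤ fromℕ (t j ℕ.* suc m)
    x≤b j = subst₂ _≤_ (x≡ j)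
      (trans (fromℤ-* (+ t j) (+ suc m)) (cong fromℤ (sym (ℤ.pos-* (t j) (suc m)))))
      (ℚ.*-monoˡ-≤-nonNeg (fromℕ (t j)) (partial≤ λs λ≤1 j))

  Π°-enumeration : Enumeration (Π° isLatticeSimplex)
  Π°-enumeration = filterEnumeration Π°? box
    (Unique.cartesianProduct⁺ (allVecs-unique ranges (λ j → range-unique _))
                              (range-unique _))
    Π°⊆box

  lectureHallPoly : Poly
  lectureHallPoly = ℓ* isLatticeSimplex Π°-enumeration

open LectureHall public using (lectureHallPoly)

-- (2r, 3r, …, nr), of length n − 1; j counts from 0
s : (n r : ℕ) → Vector ℕ (n ℕ.∸ 1)
s n r j = (2 ℕ.+ toℕ j) ℕ.* r

-- (r, 2r, …, nr)
μ : (n r : ℕ) → Vector ℕ n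
μ n r j = (1 ℕ.+ toℕ j) ℕ.* r

s>0 : ∀ n r .{{_ : NonZero r}} j → NonZero (s n r j)
s>0 n r j = ℕ.m*n≢0 (2 ℕ.+ toℕ j) r

μ>0 : ∀ n r .{{_ : NonZero r}} j → NonZero (μ n r j)
μ>0 n r j = ℕ.m*n≢0 (1 ℕ.+ toℕ j) r

-- π in one-line notation together with the colors c.
ColoredWord : ℕ → ℕ → Set
ColoredWord n r = Vec (Fin n) n × Vec (Fin r) n

IsColoredPermutation : ∀ {n r} → Pred (ColoredWord n r) 0ℓ
IsColoredPermutation (π , c) = Bijective _≡_ _≡_ (lookup π)

IsExcedance : ∀ {n r} → ColoredWord n r → Pred (Fin n) 0ℓ
IsExcedance (π , c) i =
  i Fin.< lookup π i ⊎ (lookup π i ≡ i × 0 ℕ.< toℕ (lookup c i))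

isExcedance? : ∀ {n r} (σ : ColoredWord n r) → Decidable (IsExcedance σ)
isExcedance? (π , c) i =
  (i Fin.<? lookup π i) ⊎-dec ((lookup π i Fin.≟ i) ×-dec (0 ℕ.<? toℕ (lookup c i)))

exc : ∀ {n r} → ColoredWord n r → ℕ
exc {n} σ = List.length (List.filter (isExcedance? σ) (List.allFin n))

IsDerangement : ∀ {n r} → Pred (ColoredWord n r) 0ℓ
IsDerangement σ@(π , c) =
  IsColoredPermutation σ × (∀ i → ¬ (lookup π i ≡ i × toℕ (lookup c i) ≡ 0))

injective? : ∀ {m n} (f : Fin m → Fin n) → Dec (Injective _≡_ _≡_ f)
injective? f = map′ (λ inj {x} {y} → inj x y) (λ inj x y → inj {x} {y})
  (Fin.all? λ x → Fin.all? λ y → (f x Fin.≟ f y) →-dec (x Fin.≟ y))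

surjective? : ∀ {m n} (f : Fin m → Fin n) → Dec (Surjective _≡_ _≡_ f)
surjective? f = map′ (λ sur y → proj₁ (sur y) , λ { refl → proj₂ (sur y) })
                     (λ sur y → proj₁ (sur y) , proj₂ (sur y) refl)
  (Fin.all? λ y → Fin.any? λ x → f x Fin.≟ y)

isDerangement? : ∀ {n r} → Decidable (IsDerangement {n} {r})
isDerangement? (π , c) =
  (injective? (lookup π) ×-dec surjective? (lookup π)) ×-dec
  Fin.all? (λ i → ¬? ((lookup π i Fin.≟ i) ×-dec (toℕ (lookup c i) ℕ.≟ 0)))

derangements : ∀ n r → Enumeration (IsDerangement {n} {r})
derangements n r = filterEnumeration isDerangement?
  (List.cartesianProduct (allVecs {m = n} (const (List.allFin n)))
                         (allVecs {m = n} (const (List.allFin r))))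
  (Unique.cartesianProduct⁺ (allVecs-unique _ (const (Unique.allFin⁺ n)))
                            (allVecs-unique _ (const (Unique.allFin⁺ r))))
  (λ {(π , c)} _ → ∈-cartesianProduct⁺ (∈-allVecs _ π (λ _ → ∈-allFin _))
                                       (∈-allVecs _ c (λ _ → ∈-allFin _)))

derangementPoly : ℕ → ℕ → Poly
derangementPoly n r = generatingPoly exc (derangements n r)

{-# OPTIONS --safe #-}

-- Write a lattice point of Π° as xᵢ = cᵢ tᵢ + eᵢ with 0 ≤ eᵢ < tᵢ.  All gaps lie in
-- (0 , 1) iff no two consecutive eᵢ / tᵢ agree (with 0 at both ends) and c increases
-- by 1 exactly at the descents.  Hence the two local h*-polynomials add up to the sum of
-- z^(des e + 1) over all e with 0 ≤ eᵢ < i r (1 ≤ i ≤ n), eₙ ≠ 0 and no plateaus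
-- eᵢ / i = eᵢ₊₁ / (i + 1): e₁ = 0 comes from s, and e₁ > 0 from μ.
--
-- Fix an integer z ≥ 2, let d be the linear functional on ℤ[t] with d (tᵏ) = d_{k,r}(z),
-- and put v = 1 - z, t_q = t + q v.  The initial segments of e that end with
-- e₍ₘ₊₁₎ = q (m + 1) + p contribute d (t_qᵐ) if p = 0 and
-- d ((t_q + 1) t_q^(m - p) t_{q+1}^(p - 1)) if p > 0.  This follows by induction on m,
-- since the sums over e₍ₘ₊₁₎ telescope after multiplication by v, as soon as d satisfies
-- d ((t + z) P(t)) = z d ((t + r v + z) P(t + r v)) for all P.
--
-- Now d (tⁿ) is the permanent of the matrix with entries r z above, r below and
-- (r - 1) z on the diagonal.  Cutting the image p of 0 out of its cycle 0 → p → q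
-- gives a recurrence for the minors of the first row, which yields this equation.
module Submission where

open import Data.Bool.Base using (if_then_else_)
open import Data.Fin.Base as Fin using (Fin; zero; suc; toℕ; punchIn; punchOut)
import Data.Fin.Properties as Fin
open import Data.Integer.Base as ℤ using (ℤ; +_; 0ℤ; 1ℤ; _+_; _*_; _-_; -_; _^_; ∣_∣)
import Data.Integer.Properties as ℤ
open import Data.Integer.Tactic.RingSolver using (solve-∀)
open import Data.List.Base as List using (List; []; _∷_; _++_)
open import Data.List.Membership.Propositional using (_∈_; find; lose)
open import Data.List.Membership.Propositional.Properties
  using (∈-map⁺; ∈-map⁻; ∈-concatMap⁺; ∈-concatMap⁻; ∈-cartesianProductWith⁻;
         ∈-upTo⁺; ∈-upTo⁻; ∈-allFin)
open import Data.List.Membership.Propositional.Properties.WithK using (unique∧set⇒bag)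
import Data.List.Properties as List
open import Data.List.Relation.Binary.BagAndSetEquality using (∼bag⇒↭)
open import Data.List.Relation.Binary.Permutation.Propositional as ↭ using (_↭_)
open import Data.List.Relation.Unary.All as All using ([]; _∷_)
open import Data.List.Relation.Unary.AllPairs using ([]; _∷_)
open import Data.List.Relation.Unary.Any using (here; there)
open import Data.List.Relation.Unary.Unique.Propositional using (Unique)
import Data.List.Relation.Unary.Unique.Propositional.Properties as Unique
open import Data.Nat.Base as ℕ using (ℕ; zero; suc; z≤n; s≤s; NonZero)
import Data.Nat.DivMod as ℕ
import Data.Nat.Properties as ℕ
import Data.Nat.Tactic.RingSolver as ℕ
open import Data.Product.Base using (∃; _×_; _,_; proj₁; proj₂)
open import Data.Rational.Base as ℚ using (ℚ; 0ℚ; 1ℚ)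
open import Data.Rational.Literals using (fromℤ)
import Data.Rational.Properties as ℚ
import Data.Rational.Solver as ℚ
import Data.Rational.Unnormalised.Base as ℚᵘ
import Data.Rational.Unnormalised.Properties as ℚᵘ
open import Data.Sum.Base using (_⊎_; inj₁; inj₂)
open import Data.Vec.Base as Vec using (Vec; []; _∷_; lookup)
import Data.Vec.Properties as Vec
open import Data.Vec.Functional using (Vector)
open import Function.Base using (_∘_; const)
open import Function.Bundles using (mk⇔)
open import Function.Definitions using (Injective; Bijective)
open import Level using (0ℓ)
open import Relation.Binary.Definitions using (Tri; tri<; tri≈; tri>)
open import Relation.Binary.PropositionalEquality
  using (_≡_; _≢_; refl; sym; trans; cong; cong₂; subst; subst₂; module ≡-Reasoning)
open import Relation.Nullary.Decidable
  using (Dec; yes; no; does; dec-true; dec-false; _×-dec_; _⊎-dec_)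
open import Relation.Nullary.Negation using (¬_; contradiction)
open import Relation.Unary using (Pred; Decidable)

open import Algebra.Properties.CommutativeMonoid.Sum ℤ.+-0-commutativeMonoid
  using (sum; sum-syntax; sum-cong-≗; ∑-distrib-+; ∑-comm; sum-remove)
open import Algebra.Properties.Semiring.Sum ℤ.+-*-semiring using (*-distribˡ-sum)

open import Defs

open Enumeration
open ≡-Reasoning

-- Permanents

*-distribˡ-∑ : ∀ x {n} (f : Vector ℤ n) → x * sum f ≡ ∑[ i < n ] (x * f i)
*-distribˡ-∑ x f = *-distribˡ-sum x f

per : ∀ {n} → (Fin n → Fin n → ℤ) → ℤ
per {zero}  M = 1ℤ
per {suc n} M = ∑[ p < suc n ] (M zero p * per (λ i j → M (suc i) (punchIn p j)))

per-cong : ∀ {n} {M N : Fin n → Fin n → ℤ} → (∀ i j → M i j ≡ N i j) → per M ≡ per N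
per-cong {zero}  M≗N = refl
per-cong {suc n} M≗N = sum-cong-≗ λ p →
  cong₂ _*_ (M≗N zero p) (per-cong λ i j → M≗N (suc i) (punchIn p j))

-- The increasing enumeration of the complement of {p , q}; only p ≢ q matters.
punchIn₂ : ∀ {n} (p q : Fin (suc (suc n))) → Fin n → Fin (suc (suc n))
punchIn₂ zero    zero    j       = suc (suc j)
punchIn₂ zero    (suc q) j       = suc (punchIn q j)
punchIn₂ (suc p) zero    j       = suc (punchIn p j)
punchIn₂ (suc p) (suc q) zero    = zero
punchIn₂ (suc p) (suc q) (suc j) = suc (punchIn₂ p q j)

punchIn₂-sym : ∀ {n} (p q : Fin (suc (suc n))) j → punchIn₂ p q j ≡ punchIn₂ q p j
punchIn₂-sym zero    zero    j       = refl
punchIn₂-sym zero    (suc q) j       = refl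
punchIn₂-sym (suc p) zero    j       = refl
punchIn₂-sym (suc p) (suc q) zero    = refl
punchIn₂-sym (suc p) (suc q) (suc j) = cong suc (punchIn₂-sym p q j)

punchIn₂-punchIn : ∀ {n} p (q : Fin (suc n)) j →
                   punchIn₂ p (punchIn p q) j ≡ punchIn p (punchIn q j)
punchIn₂-punchIn zero    q       j       = refl
punchIn₂-punchIn (suc p) zero    j       = refl
punchIn₂-punchIn (suc p) (suc q) zero    = refl
punchIn₂-punchIn (suc p) (suc q) (suc j) = cong suc (punchIn₂-punchIn p q j)

∑-punchIn : ∀ {n} p (f : Vector ℤ (suc n)) →
            ∑[ q < n ] f (punchIn p q) ≡ sum f - f p
∑-punchIn p f = begin
  S             ≡⟨ lemma (f p) S ⟩
  f p + S - f p ≡⟨ cong (_- f p) (sym (sum-remove {i = p} f)) ⟩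
  sum f - f p   ∎
  where
  S = sum (f ∘ punchIn p)
  lemma : ∀ a b → b ≡ a + b - a
  lemma = solve-∀

-- Both sides run over the ordered pairs of distinct indices: each is the full double sum without
-- its diagonal.
∑-punchIn-comm : ∀ {n} (f : Fin (suc n) → Fin (suc n) → ℤ) →
  ∑[ p < suc n ] ∑[ q < n ] f p (punchIn p q) ≡
  ∑[ q < suc n ] ∑[ p < n ] f (punchIn q p) q
∑-punchIn-comm {n} f = begin
  ∑[ p < suc n ] ∑[ q < n ] f p (punchIn p q)
    ≡⟨ sum-cong-≗ (λ p → ∑-punchIn p (f p)) ⟩
  ∑[ p < suc n ] (sum (f p) - f p p)
    ≡⟨ ∑-distrib-+ (λ p → sum (f p)) (λ p → - f p p) ⟩
  ∑[ p < suc n ] sum (f p) + D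
    ≡⟨ cong (_+ D) (∑-comm f) ⟩
  ∑[ q < suc n ] sum (λ p → f p q) + D
    ≡⟨ ∑-distrib-+ (λ q → sum (λ p → f p q)) (λ p → - f p p) ⟨
  ∑[ q < suc n ] (sum (λ p → f p q) - f q q)
    ≡⟨ sum-cong-≗ (λ q → sym (∑-punchIn q (λ p → f p q))) ⟩
  ∑[ q < suc n ] ∑[ p < n ] f (punchIn q p) q ∎
  where D = ∑[ p < suc n ] (- f p p)

-- Expanding row `zero` and then row `suc k` gives a sum over ordered pairs of distinct columns. By
-- `punchIn₂-sym` the remaining minor depends only on the unordered pair, so the two rows may be
-- expanded in the other order.
per-expand : ∀ {n} (M : Fin (suc n) → Fin (suc n) → ℤ) k →
  per M ≡ ∑[ p < suc n ] (M k p * per (λ i j → M (punchIn k i) (punchIn p j)))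
per-expand         M zero    = refl
per-expand {suc n} M (suc k) = begin
  ∑[ p < suc (suc n) ] (M zero p * per (λ i j → M (suc i) (punchIn p j)))
    ≡⟨ sum-cong-≗ (λ p → trans
         (cong (M zero p *_) (per-expand (λ i j → M (suc i) (punchIn p j)) k))
         (*-distribˡ-∑ (M zero p) (λ q → M (suc k) (punchIn p q) *
           per (λ i j → M (suc (punchIn k i)) (punchIn p (punchIn q j)))))) ⟩
  ∑[ p < suc (suc n) ] ∑[ q < suc n ] (M zero p * (M (suc k) (punchIn p q) *
    per (λ i j → M (suc (punchIn k i)) (punchIn p (punchIn q j)))))
    ≡⟨ sum-cong-≗ (λ p → sum-cong-≗ (λ q →
         cong (λ x → M zero p * (M (suc k) (punchIn p q) * x))
           (per-cong (λ i j → cong (M (suc (punchIn k i))) (sym (punchIn₂-punchIn p q j)))))) ⟩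
  ∑[ p < suc (suc n) ] ∑[ q < suc n ] f p (punchIn p q)
    ≡⟨ ∑-punchIn-comm f ⟩
  ∑[ q < suc (suc n) ] ∑[ p < suc n ] f (punchIn q p) q
    ≡⟨ sum-cong-≗ (λ q → sum-cong-≗ (λ p → trans
         (lemma (M zero (punchIn q p)) (M (suc k) q) _)
         (cong (λ x → M (suc k) q * (M zero (punchIn q p) * x))
           (per-cong (λ i j → cong (M (suc (punchIn k i)))
             (trans (punchIn₂-sym (punchIn q p) q j) (punchIn₂-punchIn q p j))))))) ⟩
  ∑[ q < suc (suc n) ] ∑[ p < suc n ] (M (suc k) q * (M zero (punchIn q p) *
    per (λ i j → M (suc (punchIn k i)) (punchIn q (punchIn p j)))))
    ≡⟨ sum-cong-≗ (λ q → sym (*-distribˡ-∑ (M (suc k) q) (λ p → M zero (punchIn q p) *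
         per (λ i j → M (suc (punchIn k i)) (punchIn q (punchIn p j)))))) ⟩
  ∑[ q < suc (suc n) ]
    (M (suc k) q * per (λ i j → M (punchIn (suc k) i) (punchIn q j))) ∎
  where
  f : Fin (suc (suc n)) → Fin (suc (suc n)) → ℤ
  f p q = M zero p * (M (suc k) q *
    per (λ i j → M (suc (punchIn k i)) (punchIn₂ p q j)))
  lemma : ∀ a b c → a * (b * c) ≡ b * (a * c)
  lemma = solve-∀

-- Finite sums and linear functionals

∑< : ℕ → (ℕ → ℤ) → ℤ
∑< n f = ∑[ i < n ] f (toℕ i)

∑<-last : ∀ n f → ∑< (suc n) f ≡ ∑< n f + f n
∑<-last zero    f = ℤ.+-comm (f 0) 0ℤ
∑<-last (suc n) f = trans (cong (λ x → f 0 + x) (∑<-last n (f ∘ suc))) (sym (ℤ.+-assoc (f 0) _ _))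

∑<-+ : ∀ m n f → ∑< (m ℕ.+ n) f ≡ ∑< m f + ∑< n (λ i → f (m ℕ.+ i))
∑<-+ zero    n f = sym (ℤ.+-identityˡ _)
∑<-+ (suc m) n f = trans (cong (λ x → f 0 + x) (∑<-+ m n (f ∘ suc))) (sym (ℤ.+-assoc (f 0) _ _))

∑<-cong : ∀ n {f g : ℕ → ℤ} → (∀ i → i ℕ.< n → f i ≡ g i) → ∑< n f ≡ ∑< n g
∑<-cong n f≗g = sum-cong-≗ {n} (λ i → f≗g (toℕ i) (Fin.toℕ<n i))

*-distribˡ-∑< : ∀ x n f → x * ∑< n f ≡ ∑< n (λ i → x * f i)
*-distribˡ-∑< x n f = *-distribˡ-∑ x {n} (f ∘ toℕ)

-- A sequence s stands for the linear functional tᵏ ↦ s k on ℤ[t]; then mul y s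
-- is the functional P ↦ s ((t + y) P).
mul : ℤ → (ℕ → ℤ) → ℕ → ℤ
mul y s k = s (suc k) + y * s k

pow : ℤ → ℕ → (ℕ → ℤ) → ℕ → ℤ
pow y zero    s = s
pow y (suc n) s = mul y (pow y n s)

mul-cong : ∀ y {s s′} → (∀ k → s k ≡ s′ k) → ∀ k → mul y s k ≡ mul y s′ k
mul-cong y s≗s′ k = cong₂ (λ a b → a + y * b) (s≗s′ (suc k)) (s≗s′ k)

mul-comm : ∀ x y s k → mul x (mul y s) k ≡ mul y (mul x s) k
mul-comm x y s k = lemma x y (s (suc (suc k))) (s (suc k)) (s k)
  where
  lemma : ∀ x y a b c → (a + y * b) + x * (b + y * c) ≡ (a + x * b) + y * (b + x * c)
  lemma = solve-∀

mul-pow-comm : ∀ x y n s k → mul x (pow y n s) k ≡ pow y n (mul x s) k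
mul-pow-comm x y zero    s k = refl
mul-pow-comm x y (suc n) s k = trans (mul-comm x y (pow y n s) k) (mul-cong y (mul-pow-comm x y n s) k)

-- Sums over derangements

module Derangements (z r : ℤ) where

  -- The difference `r - r z` between the entries below and above the diagonal; with `v = 1 - z` it
  -- is the shift `r v`.
  ρ : ℤ
  ρ = r * (1ℤ - z)

  -- An entry counts the colors allowed at position `i` with image `j`, with a factor `z` for an
  -- excedance; color 0 is excluded on the diagonal.
  weight : ∀ {m n} → Fin m → Fin n → ℤ
  weight zero    zero    = (r - 1ℤ) * z
  weight zero    (suc j) = r * z
  weight (suc i) zero    = r
  weight (suc i) (suc j) = weight i j

  d : ℕ → ℤ
  d n = per {n} weight

  -- Entries depend only on the order of `i` and `j`, which the strictly increasing map `punchIn p`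
  -- preserves.
  weight-punchIn : ∀ {m} (p : Fin (suc m)) (i j : Fin m) →
                   weight (punchIn p i) (punchIn p j) ≡ weight i j
  weight-punchIn zero    i       j       = refl
  weight-punchIn (suc p) zero    zero    = refl
  weight-punchIn (suc p) zero    (suc j) = refl
  weight-punchIn (suc p) (suc i) zero    = refl
  weight-punchIn (suc p) (suc i) (suc j) = weight-punchIn p i j

  minor : ∀ {m} → Fin (suc m) → ℤ
  minor {m} p = per {m} (λ i j → weight (suc i) (punchIn p j))

  -- In terms of permutations, p is cut out of its cycle 0 → p → q.
  minor-suc : ∀ {m} (p : Fin (suc m)) →
    minor (suc p) ≡ ∑[ q < suc m ] (weight (suc p) (punchIn (suc p) q) * minor q)
  minor-suc {m} p = trans
    (per-expand (λ i j → weight (suc i) (punchIn (suc p) j)) p)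
    (sum-cong-≗ λ q → cong (weight (suc p) (punchIn (suc p) q) *_)
      (per-cong λ i j → weight-punchIn (suc p) (suc i) (punchIn q j)))

  -- Left of the diagonal the entry is `r = r z + ρ` and right of it `r z`, so `ρ` multiplies only
  -- the sum over the first `p` terms.
  row-sum : ∀ {m} (p : Fin (suc m)) (g : ℕ → ℤ) →
    ∑[ q < m ] (weight p (punchIn p q) * g (toℕ q)) ≡
    r * z * ∑< m g + ρ * ∑< (toℕ p) g
  row-sum {m} zero g = begin
    ∑[ q < m ] (r * z * g (toℕ q))  ≡⟨ *-distribˡ-∑< (r * z) m g ⟨
    r * z * ∑< m g                  ≡⟨ lemma (r * z * ∑< m g) ρ ⟩
    r * z * ∑< m g + ρ * 0ℤ         ∎
    where
    lemma : ∀ a b → a ≡ a + b * 0ℤ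
    lemma = solve-∀
  row-sum {suc m} (suc p) g = begin
    r * g 0 + ∑[ q < m ] (weight p (punchIn p q) * g (suc (toℕ q)))
      ≡⟨ cong (λ x → r * g 0 + x) (row-sum p (g ∘ suc)) ⟩
    r * g 0 + (r * z * ∑< m (g ∘ suc) + ρ * ∑< (toℕ p) (g ∘ suc))
      ≡⟨ lemma r z (g 0) (∑< m (g ∘ suc)) (∑< (toℕ p) (g ∘ suc)) ⟩
    r * z * (g 0 + ∑< m (g ∘ suc)) + ρ * (g 0 + ∑< (toℕ p) (g ∘ suc)) ∎
    where
    lemma : ∀ r z a b c → r * a + (r * z * b + r * (1ℤ - z) * c) ≡
                          r * z * (a + b) + r * (1ℤ - z) * (a + c)
    lemma = solve-∀

  -- In terms of functionals, `β i k` is `d ((t + z + ρ) (t + ρ)^i t^k)`.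
  β : ℕ → ℕ → ℤ
  β i = pow ρ i (mul (z + ρ) d)

  -- The relation `(t + ρ)^(i+1) t^k = (t + ρ)^i t^(k+1) + ρ (t + ρ)^i t^k` with `k = m - i -
  -- 1` telescopes over `i < p`.
  β-telescope : ∀ m p → p ℕ.≤ m →
    β p (m ℕ.∸ p) ≡ β 0 m + ρ * ∑< p (λ i → β i (m ℕ.∸ suc i))
  β-telescope m zero    _   = lemma (β 0 m) ρ
    where
    lemma : ∀ a b → a ≡ a + b * 0ℤ
    lemma = solve-∀
  β-telescope m (suc p) p<m = begin
    β p (suc (m ℕ.∸ suc p)) + ρ * β p (m ℕ.∸ suc p)
      ≡⟨ cong (λ k → β p k + ρ * g p) (sym (ℕ.+-∸-assoc 1 p<m)) ⟩
    β p (m ℕ.∸ p) + ρ * g p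
      ≡⟨ cong (_+ ρ * g p) (β-telescope m p (ℕ.<⇒≤ p<m)) ⟩
    β 0 m + ρ * ∑< p g + ρ * g p
      ≡⟨ lemma (β 0 m) ρ (∑< p g) (g p) ⟩
    β 0 m + ρ * (∑< p g + g p)
      ≡⟨ cong (λ x → β 0 m + ρ * x) (∑<-last p g) ⟨
    β 0 m + ρ * ∑< (suc p) g ∎
    where
    g = λ i → β i (m ℕ.∸ suc i)
    lemma : ∀ a b x y → a + b * x + b * y ≡ a + b * (x + y)
    lemma = solve-∀

  private
    ∑β : ℕ → ℤ
    ∑β m = ∑< m (λ i → β i (m ℕ.∸ suc i))

  -- This is the expansion along the first row. The formula for the minors is an argument because
  -- the induction behind `minor≡β` uses this expansion at the previous size.
  d-suc′ : ∀ m → (∀ (q : Fin m) → minor (suc q) ≡ β (toℕ q) (m ℕ.∸ suc (toℕ q))) →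
           d (suc m) ≡ (r - 1ℤ) * z * d m + r * z * ∑β m
  d-suc′ m minor≡β = cong (λ x → (r - 1ℤ) * z * d m + x) (trans
    (sym (*-distribˡ-∑ (r * z) {m} (minor ∘ suc)))
    (cong (r * z *_) (sum-cong-≗ minor≡β)))

  -- By induction the smaller minors are values of `β`, and `row-sum` splits their weighted sum at
  -- `p`. The full sum combines into `d (suc m)`, and the partial sum telescopes.
  minor≡β : ∀ m (q : Fin m) → minor (suc q) ≡ β (toℕ q) (m ℕ.∸ suc (toℕ q))
  minor≡β (suc m) p = begin
    minor (suc p)
      ≡⟨ minor-suc p ⟩
    -- The term `q = zero` has weight `r` and minor `d m`.
    r * d m + ∑[ q < m ] (weight p (punchIn p q) * minor (suc q))
      ≡⟨ cong (λ x → r * d m + x) (sum-cong-≗ (λ q →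
           cong (weight p (punchIn p q) *_) (minor≡β m q))) ⟩
    r * d m + ∑[ q < m ] (weight p (punchIn p q) * g (toℕ q))
      ≡⟨ cong (λ x → r * d m + x) (row-sum p g) ⟩
    r * d m + (r * z * ∑β m + ρ * ∑< (toℕ p) g)
      ≡⟨ lemma r z (d m) (∑β m) (∑< (toℕ p) g) ⟩
    ((r - 1ℤ) * z * d m + r * z * ∑β m) + (z + ρ) * d m + ρ * ∑< (toℕ p) g
      ≡⟨ cong (λ x → x + (z + ρ) * d m + ρ * ∑< (toℕ p) g) (d-suc′ m (minor≡β m)) ⟨
    β 0 m + ρ * ∑< (toℕ p) g
      ≡⟨ β-telescope m (toℕ p) (ℕ.s≤s⁻¹ (Fin.toℕ<n p)) ⟨
    β (toℕ p) (m ℕ.∸ toℕ p) ∎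
    where
    g = λ i → β i (m ℕ.∸ suc i)
    lemma : ∀ r z x s t → r * x + (r * z * s + r * (1ℤ - z) * t) ≡
      ((r - 1ℤ) * z * x + r * z * s) + (z + r * (1ℤ - z)) * x + r * (1ℤ - z) * t
    lemma = solve-∀

  d-suc : ∀ m → d (suc m) ≡ (r - 1ℤ) * z * d m + r * z * ∑β m
  d-suc m = d-suc′ m (minor≡β m)

  -- The functional equation d ((t + z) P(t)) = z d ((t + ρ + z) P(t + ρ)) for P = tᵐ.
  d-shift : ∀ m → mul z d m ≡ z * mul (z + ρ) (pow ρ m d) 0
  d-shift m = sym (begin
    z * mul (z + ρ) (pow ρ m d) 0
      ≡⟨ cong (z *_) (mul-pow-comm (z + ρ) ρ m d 0) ⟩
    z * β m 0
      ≡⟨ cong (λ k → z * β m k) (ℕ.n∸n≡0 m) ⟨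
    -- At `p = m` the telescoped sum is the full `∑β m`, which `d-suc` then eliminates.
    z * β m (m ℕ.∸ m)
      ≡⟨ cong (z *_) (β-telescope m m ℕ.≤-refl) ⟩
    z * (d (suc m) + (z + ρ) * d m + ρ * ∑β m)
      ≡⟨ lemma₁ r z (d (suc m)) (d m) (∑β m) ⟩
    z * d (suc m) + z * (z + ρ) * d m + (1ℤ - z) * (r * z * ∑β m)
      ≡⟨ lemma₂ r z (d (suc m)) (d m) (r * z * ∑β m) ⟩
    z * d (suc m) + (1ℤ - z) * ((r - 1ℤ) * z * d m + r * z * ∑β m) + z * d m
      ≡⟨ cong (λ x → z * d (suc m) + (1ℤ - z) * x + z * d m) (d-suc m) ⟨
    z * d (suc m) + (1ℤ - z) * d (suc m) + z * d m
      ≡⟨ lemma₃ z (d (suc m)) (d m) ⟩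
    d (suc m) + z * d m ∎)
    where
    lemma₁ : ∀ r z x y s → z * (x + (z + r * (1ℤ - z)) * y + r * (1ℤ - z) * s) ≡
      z * x + z * (z + r * (1ℤ - z)) * y + (1ℤ - z) * (r * z * s)
    lemma₁ = solve-∀
    lemma₂ : ∀ r z x y s → z * x + z * (z + r * (1ℤ - z)) * y + (1ℤ - z) * s ≡
      z * x + (1ℤ - z) * ((r - 1ℤ) * z * y + s) + z * y
    lemma₂ = solve-∀
    lemma₃ : ∀ z x y → z * x + (1ℤ - z) * x + z * y ≡ x + z * y
    lemma₃ = solve-∀

-- Inversion sequences

select : ∀ {a} {X : Set} {A B C : Set a} → Tri A B C → X → X → X → X
select (tri< _ _ _) x y w = x
select (tri≈ _ _ _) x y w = y
select (tri> _ _ _) x y w = w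

module Inversion (z : ℤ) where

  -- The weight of a step from e / τ to e′ / τ′: ascent, plateau or descent.
  kernel : ℕ → ℕ → ℕ → ℕ → ℤ
  kernel τ e τ′ e′ = select (ℕ.<-cmp (e ℕ.* τ′) (e′ ℕ.* τ)) 1ℤ 0ℤ z

  kernel-< : ∀ τ e τ′ e′ → e ℕ.* τ′ ℕ.< e′ ℕ.* τ → kernel τ e τ′ e′ ≡ 1ℤ
  kernel-< τ e τ′ e′ lt with ℕ.<-cmp (e ℕ.* τ′) (e′ ℕ.* τ)
  ... | tri< _ _ _ = refl
  ... | tri≈ ¬lt _ _ = contradiction lt ¬lt
  ... | tri> ¬lt _ _ = contradiction lt ¬lt

  kernel-≡ : ∀ τ e τ′ e′ → e ℕ.* τ′ ≡ e′ ℕ.* τ → kernel τ e τ′ e′ ≡ 0ℤ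
  kernel-≡ τ e τ′ e′ eq with ℕ.<-cmp (e ℕ.* τ′) (e′ ℕ.* τ)
  ... | tri< _ ¬eq _ = contradiction eq ¬eq
  ... | tri≈ _ _ _ = refl
  ... | tri> _ ¬eq _ = contradiction eq ¬eq

  kernel-> : ∀ τ e τ′ e′ → e′ ℕ.* τ ℕ.< e ℕ.* τ′ → kernel τ e τ′ e′ ≡ z
  kernel-> τ e τ′ e′ gt with ℕ.<-cmp (e ℕ.* τ′) (e′ ℕ.* τ)
  ... | tri< _ _ ¬gt = contradiction gt ¬gt
  ... | tri≈ _ _ ¬gt = contradiction gt ¬gt
  ... | tri> _ _ _ = refl

  -- This is the weight of a step to the fraction 0 / 1: a plateau from 0, a descent from anything
  -- larger.
  final : ℕ → ℤ
  final zero    = 0ℤ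
  final (suc _) = z

  -- Inversion sequences without plateaus that continue an entry e of bound τ,
  -- weighted by descents; a final nonzero entry counts as a descent.
  W : ∀ {k} → ℕ → ℕ → Vector ℕ k → ℤ
  W {zero}  τ e t = final e
  W {suc k} τ e t = ∑< (t zero) (λ e′ → kernel τ e (t zero) e′ * W (t zero) e′ (t ∘ suc))

  -- Below `T` the weight 1 is split as `(1 - z) + z`.
  ∑<-threshold : ∀ T N (κ f : ℕ → ℤ) →
    (∀ e → e ℕ.< T → κ e ≡ 1ℤ) → (∀ e → T ℕ.≤ e → κ e ≡ z) →
    ∑< (T ℕ.+ N) (λ e → κ e * f e) ≡ (1ℤ - z) * ∑< T f + z * ∑< (T ℕ.+ N) f
  ∑<-threshold T N κ f below above = begin
    ∑< (T ℕ.+ N) (λ e → κ e * f e)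
      ≡⟨ ∑<-+ T N (λ e → κ e * f e) ⟩
    ∑< T (λ e → κ e * f e) + ∑< N (λ e → κ (T ℕ.+ e) * f (T ℕ.+ e))
      ≡⟨ cong₂ _+_
           (∑<-cong T (λ e e<T → trans (cong (_* f e) (below e e<T)) (ℤ.*-identityˡ (f e))))
           (∑<-cong N (λ e _ → cong (_* f (T ℕ.+ e)) (above (T ℕ.+ e) (ℕ.m≤m+n T e)))) ⟩
    ∑< T f + ∑< N (λ e → z * f (T ℕ.+ e))
      ≡⟨ cong (λ x → ∑< T f + x) (*-distribˡ-∑< z N (λ e → f (T ℕ.+ e))) ⟨
    ∑< T f + z * ∑< N (λ e → f (T ℕ.+ e))
      ≡⟨ lemma z (∑< T f) _ ⟩
    (1ℤ - z) * ∑< T f + z * (∑< T f + ∑< N (λ e → f (T ℕ.+ e)))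
      ≡⟨ cong (λ x → (1ℤ - z) * ∑< T f + z * x) (∑<-+ T N f) ⟨
    (1ℤ - z) * ∑< T f + z * ∑< (T ℕ.+ N) f ∎
    where
    lemma : ∀ z a b → a + z * b ≡ (1ℤ - z) * a + z * (a + b)
    lemma = solve-∀

  -- As before, but the plateau at `T` has weight 0, so its share `z * f T` is taken away.
  ∑<-threshold-skip : ∀ T N (κ f : ℕ → ℤ) →
    (∀ e → e ℕ.< T → κ e ≡ 1ℤ) → κ T ≡ 0ℤ → (∀ e → T ℕ.< e → κ e ≡ z) →
    ∑< (T ℕ.+ suc N) (λ e → κ e * f e) ≡
    (1ℤ - z) * ∑< T f + z * ∑< (T ℕ.+ suc N) f - z * f T
  ∑<-threshold-skip T N κ f below at above = begin
    ∑< (T ℕ.+ suc N) (λ e → κ e * f e)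
      ≡⟨ ∑<-+ T (suc N) (λ e → κ e * f e) ⟩
    ∑< T (λ e → κ e * f e) +
      (κ (T ℕ.+ 0) * f (T ℕ.+ 0) + ∑< N (λ e → κ (T ℕ.+ suc e) * f (T ℕ.+ suc e)))
      ≡⟨ cong₂ _+_
           (∑<-cong T (λ e e<T → trans (cong (_* f e) (below e e<T)) (ℤ.*-identityˡ (f e))))
           (cong₂ _+_ (cong (_* f (T ℕ.+ 0)) (trans (cong κ (ℕ.+-identityʳ T)) at))
             (∑<-cong N (λ e _ → cong (_* f (T ℕ.+ suc e))
               (above (T ℕ.+ suc e) (ℕ.m<m+n T (s≤s z≤n)))))) ⟩
    ∑< T f + (0ℤ * f (T ℕ.+ 0) + ∑< N (λ e → z * f (T ℕ.+ suc e)))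
      ≡⟨ cong (λ x → ∑< T f + (0ℤ * f (T ℕ.+ 0) + x)) (*-distribˡ-∑< z N (λ e → f (T ℕ.+ suc e))) ⟨
    ∑< T f + (0ℤ * f (T ℕ.+ 0) + z * ∑< N (λ e → f (T ℕ.+ suc e)))
      ≡⟨ lemma z (∑< T f) (f (T ℕ.+ 0)) _ ⟩
    (1ℤ - z) * ∑< T f + z * (∑< T f + (f (T ℕ.+ 0) + ∑< N (λ e → f (T ℕ.+ suc e)))) - z * f (T ℕ.+ 0)
      ≡⟨ cong₂ (λ x y → (1ℤ - z) * ∑< T f + z * x - z * f y)
           (sym (∑<-+ T (suc N) f)) (ℕ.+-identityʳ T) ⟩
    (1ℤ - z) * ∑< T f + z * ∑< (T ℕ.+ suc N) f - z * f T ∎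
    where
    lemma : ∀ z a b c → a + (0ℤ * b + z * c) ≡ (1ℤ - z) * a + z * (a + (b + c)) - z * b
    lemma = solve-∀

  module Forward (r : ℕ) .{{_ : NonZero r}} where

    -- Initial segments e₁ , … , e₍ₘ₊₁₎ = e′; the value e₁ = 0 is allowed.
    F : ℕ → ℕ → ℤ
    F zero    e′ = 1ℤ
    F (suc m) e′ = ∑< (suc m ℕ.* r) λ e →
      kernel (suc m ℕ.* r) e (suc (suc m) ℕ.* r) e′ * F m e

    -- Exchanging the order of summation moves one entry at a time from the continuation `W` into
    -- the initial segment `F`; the total does not depend on where a sequence is cut.
    adjoint : ∀ {k} m (t : Vector ℕ k) → (∀ i → t i ≡ (suc (suc m) ℕ.+ toℕ i) ℕ.* r) →
      ∑< (suc m ℕ.* r) (λ e → F m e * W (suc m ℕ.* r) e t) ≡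
      ∑< (suc (m ℕ.+ k) ℕ.* r) (λ e → F (m ℕ.+ k) e * final e)
    adjoint {zero}  m t t≡ =
      cong (λ M → ∑< (suc M ℕ.* r) (λ e → F M e * final e)) (sym (ℕ.+-identityʳ m))
    -- The rewriting gives `t zero` the form of the bound in the recursion for `F`.
    adjoint {suc k} m t t≡ rewrite trans (t≡ zero) (cong (ℕ._* r) (ℕ.+-identityʳ (suc (suc m)))) = begin
      ∑< τ (λ e → F m e * ∑< τ′ (λ e′ → κ e e′ * W′ e′))
        ≡⟨ ∑<-cong τ (λ e _ → trans (*-distribˡ-∑< (F m e) τ′ (λ e′ → κ e e′ * W′ e′))
             (∑<-cong τ′ (λ e′ _ → lemma (F m e) (κ e e′) (W′ e′)))) ⟩
      ∑< τ (λ e → ∑< τ′ (λ e′ → W′ e′ * (κ e e′ * F m e)))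
        ≡⟨ ∑-comm {τ} {τ′} (λ i j → W′ (toℕ j) * (κ (toℕ i) (toℕ j) * F m (toℕ i))) ⟩
      ∑< τ′ (λ e′ → ∑< τ (λ e → W′ e′ * (κ e e′ * F m e)))
        ≡⟨ ∑<-cong τ′ (λ e′ _ → trans
             (sym (*-distribˡ-∑< (W′ e′) τ (λ e → κ e e′ * F m e)))
             (ℤ.*-comm (W′ e′) (F (suc m) e′))) ⟩
      ∑< τ′ (λ e′ → F (suc m) e′ * W′ e′)
        ≡⟨ adjoint (suc m) (t ∘ suc) (λ i → trans (t≡ (suc i))
             (cong (ℕ._* r) (ℕ.+-suc (suc (suc m)) (toℕ i)))) ⟩
      ∑< (suc (suc m ℕ.+ k) ℕ.* r) (λ e → F (suc m ℕ.+ k) e * final e)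
        ≡⟨ cong (λ M → ∑< (suc M ℕ.* r) (λ e → F M e * final e)) (sym (ℕ.+-suc m k)) ⟩
      ∑< (suc (m ℕ.+ suc k) ℕ.* r) (λ e → F (m ℕ.+ suc k) e * final e) ∎
      where
      τ  = suc m ℕ.* r
      τ′ = suc (suc m) ℕ.* r
      κ  = λ e e′ → kernel τ e τ′ e′
      W′ = λ e′ → W τ′ e′ (t ∘ suc)
      lemma : ∀ a b c → a * (b * c) ≡ c * (b * a)
      lemma = solve-∀

    module Closed (d : ℕ → ℤ) (d-zero : d 0 ≡ 1ℤ) (v≢0 : 1ℤ - z ≢ 0ℤ)
                  (d-shift : ∀ m → mul z d m ≡
                            z * mul (z + + r * (1ℤ - z)) (pow (+ r * (1ℤ - z)) m d) 0) where

      v = 1ℤ - z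

      -- H q m and, for m = a + b + 1, G q a b are the values of F m at q (m + 1) and
      -- at q (m + 1) + b + 1; C q m - C 0 m is v times the sum of F m over [0 , q (m + 1)).
      H : ℕ → ℕ → ℤ
      H q m = pow (+ q * v) m d 0

      G : ℕ → ℕ → ℕ → ℤ
      G q a b = mul (+ q * v + 1ℤ) (pow (+ q * v) a (pow (+ suc q * v) b d)) 0

      C : ℕ → ℕ → ℤ
      C q m = mul (+ q * v + z) (pow (+ q * v) m d) 0

      -- On polynomials: `(t_q + z) + v = t_q + 1`.
      C+vH : ∀ q m → C q m + v * H q m ≡ G q m 0
      C+vH q m = lemma z (+ q * v) (pow (+ q * v) m d 1) (H q m)
        where
        lemma : ∀ z y a b → (a + (y + z) * b) + (1ℤ - z) * b ≡ a + (y + 1ℤ) * b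
        lemma = solve-∀

      C-zH : ∀ q m → C q m - z * H q m ≡ H q (suc m)
      C-zH q m = lemma z (+ q * v) (pow (+ q * v) m d 1) (H q m)
        where
        lemma : ∀ z y a b → (a + (y + z) * b) - z * b ≡ a + y * b
        lemma = solve-∀

      suc*v : ∀ q → + suc q * v ≡ + q * v + v
      suc*v q = trans (cong (_* v) (ℤ.pos-+ 1 q)) (lemma (+ q) v)
        where
        lemma : ∀ a v → (1ℤ + a) * v ≡ a * v + v
        lemma = solve-∀

      -- One factor `t_q` turns into `t_q + v = t_{q+1}`.
      G-step : ∀ q a b → G q (suc a) b + v * G q a b ≡ G q a (suc b)
      G-step q a b = begin
        mul u (mul y X) 0 + v * mul u X 0
          ≡⟨ lemma u y v (X 2) (X 1) (X 0) ⟩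
        mul u (mul (y + v) X) 0
          ≡⟨ cong (λ x → mul u (mul x X) 0) (suc*v q) ⟨
        mul u (mul (+ suc q * v) X) 0
          ≡⟨ mul-cong u (mul-pow-comm (+ suc q * v) y a (pow (+ suc q * v) b d)) 0 ⟩
        mul u (pow y a (pow (+ suc q * v) (suc b) d)) 0 ∎
        where
        y = + q * v
        u = + q * v + 1ℤ
        X = pow y a (pow (+ suc q * v) b d)
        lemma : ∀ u y v a b c → ((a + y * b) + u * (b + y * c)) + v * (b + u * c) ≡
          (a + (y + v) * b) + u * (b + (y + v) * c)
        lemma = solve-∀

      -- On polynomials: `t_q + 1 = t_{q+1} + z`. This joins the end of one block of values to the
      -- start of the next.
      G-last : ∀ q m → G q 0 m ≡ C (suc q) m
      G-last q m = cong (λ x → mul x (pow (+ suc q * v) m d) 0)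
        (trans (lemma (+ q * v) z) (cong (_+ z) (sym (suc*v q))))
        where
        lemma : ∀ y z → y + 1ℤ ≡ y + (1ℤ - z) + z
        lemma = solve-∀

      pow-0 : ∀ m k → pow (0ℤ * v) m d k ≡ d (m ℕ.+ k)
      pow-0 zero    k = refl
      pow-0 (suc m) k = begin
        pow (0ℤ * v) m d (suc k) + 0ℤ * v * pow (0ℤ * v) m d k
          ≡⟨ lemma (pow (0ℤ * v) m d (suc k)) v (pow (0ℤ * v) m d k) ⟩
        pow (0ℤ * v) m d (suc k)
          ≡⟨ pow-0 m (suc k) ⟩
        d (m ℕ.+ suc k)
          ≡⟨ cong d (ℕ.+-suc m k) ⟩
        d (suc m ℕ.+ k) ∎
        where
        lemma : ∀ a v b → a + 0ℤ * v * b ≡ a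
        lemma = solve-∀

      H-0 : ∀ m → H 0 m ≡ d m
      H-0 m = trans (pow-0 m 0) (cong d (ℕ.+-identityʳ m))

      C-0 : ∀ m → C 0 m ≡ mul z d m
      C-0 m = begin
        pow (0ℤ * v) m d 1 + (0ℤ * v + z) * H 0 m
          ≡⟨ cong₂ (λ a b → a + (0ℤ * v + z) * b)
               (trans (pow-0 m 1) (cong d (ℕ.+-comm m 1))) (H-0 m) ⟩
        d (suc m) + (0ℤ * v + z) * d m
          ≡⟨ lemma z v (d (suc m)) (d m) ⟩
        d (suc m) + z * d m ∎
        where
        lemma : ∀ z v a b → a + (0ℤ * v + z) * b ≡ a + z * b
        lemma = solve-∀

      -- This is the functional equation of `d`, since `t_r` is `t` shifted by `r v`.
      zC-r : ∀ m → z * C r m ≡ C 0 m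
      zC-r m = trans
        (cong (λ y → z * mul y (pow (+ r * v) m d) 0) (ℤ.+-comm (+ r * v) z))
        (trans (sym (d-shift m)) (sym (C-0 m)))

      F≡H : ℕ → Set
      F≡H m = ∀ q → q ℕ.< r → F m (q ℕ.* suc m) ≡ H q m

      F≡G : ℕ → Set
      F≡G m = ∀ q a b → q ℕ.< r → suc (a ℕ.+ b) ≡ m → F m (q ℕ.* suc m ℕ.+ suc b) ≡ G q a b

      module Prefix (m : ℕ) (F≡Hₘ : F≡H m) (F≡Gₘ : F≡G m) where

        -- `C+vH` accounts for the value at `p = 0`; each further value trades one factor `t_q` for
        -- `t_{q+1}` by `G-step`.
        block : ∀ q a b → q ℕ.< r → a ℕ.+ b ≡ m →
          v * ∑< (suc b) (λ p → F m (q ℕ.* suc m ℕ.+ p)) ≡ G q a b - C q m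
        block q a zero q<r a+b≡m = begin
          v * (F m (q ℕ.* suc m ℕ.+ 0) + 0ℤ)
            ≡⟨ cong (λ x → v * (x + 0ℤ)) (trans (cong (F m) (ℕ.+-identityʳ _)) (F≡Hₘ q q<r)) ⟩
          v * (H q m + 0ℤ)
            ≡⟨ lemma v (H q m) (C q m) ⟩
          C q m + v * H q m - C q m
            ≡⟨ cong (_- C q m) (C+vH q m) ⟩
          G q m 0 - C q m
            ≡⟨ cong (λ a → G q a 0 - C q m) (trans (sym a+b≡m) (ℕ.+-identityʳ a)) ⟩
          G q a 0 - C q m ∎
          where
          lemma : ∀ v h c → v * (h + 0ℤ) ≡ c + v * h - c
          lemma = solve-∀
        block q a (suc b) q<r a+b≡m = begin
          v * ∑< (suc (suc b)) f
            ≡⟨ cong (v *_) (∑<-last (suc b) f) ⟩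
          v * (∑< (suc b) f + f (suc b))
            ≡⟨ ℤ.*-distribˡ-+ v (∑< (suc b) f) (f (suc b)) ⟩
          v * ∑< (suc b) f + v * f (suc b)
            ≡⟨ cong₂ (λ x y → x + v * y) (block q (suc a) b q<r a+b′≡m) (F≡Gₘ q a b q<r a+b′≡m) ⟩
          G q (suc a) b - C q m + v * G q a b
            ≡⟨ lemma (G q (suc a) b) (C q m) (v * G q a b) ⟩
          G q (suc a) b + v * G q a b - C q m
            ≡⟨ cong (_- C q m) (G-step q a b) ⟩
          G q a (suc b) - C q m ∎
          where
          f = λ p → F m (q ℕ.* suc m ℕ.+ p)
          a+b′≡m = trans (sym (ℕ.+-suc a b)) a+b≡m
          lemma : ∀ a b c → a - b + c ≡ a + c - b
          lemma = solve-∀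

        -- The range consists of `q` full blocks of length `m + 1`, whose contributions telescope by
        -- `G-last`.
        prefix : ∀ q → q ℕ.≤ r → v * ∑< (q ℕ.* suc m) (F m) ≡ C q m - C 0 m
        prefix zero    _   = lemma v (C 0 m)
          where
          lemma : ∀ v c → v * 0ℤ ≡ c - c
          lemma = solve-∀
        prefix (suc q) q<r = begin
          v * ∑< (suc m ℕ.+ q ℕ.* suc m) (F m)
            ≡⟨ cong (λ k → v * ∑< k (F m)) (ℕ.+-comm (suc m) (q ℕ.* suc m)) ⟩
          v * ∑< (q ℕ.* suc m ℕ.+ suc m) (F m)
            ≡⟨ cong (v *_) (∑<-+ (q ℕ.* suc m) (suc m) (F m)) ⟩
          v * (∑< (q ℕ.* suc m) (F m) + ∑< (suc m) (λ p → F m (q ℕ.* suc m ℕ.+ p)))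
            ≡⟨ ℤ.*-distribˡ-+ v (∑< (q ℕ.* suc m) (F m)) _ ⟩
          v * ∑< (q ℕ.* suc m) (F m) + v * ∑< (suc m) (λ p → F m (q ℕ.* suc m ℕ.+ p))
            ≡⟨ cong₂ _+_ (prefix q (ℕ.<⇒≤ q<r)) (block q 0 m q<r refl) ⟩
          C q m - C 0 m + (G q 0 m - C q m)
            ≡⟨ lemma (C q m) (C 0 m) (G q 0 m) ⟩
          G q 0 m - C 0 m
            ≡⟨ cong (_- C 0 m) (G-last q m) ⟩
          C (suc q) m - C 0 m ∎
          where
          lemma : ∀ a b c → a - b + (c - a) ≡ c - b
          lemma = solve-∀

        -- The prefix sum at `q = r` gives `z v S = z C r m - z C 0 m`, where `S` is the full sum.
        -- The functional equation turns the right side into `v C 0 m`, and `v` is cancelled.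
        total : z * ∑< (suc m ℕ.* r) (F m) ≡ C 0 m
        total = ℤ.*-cancelˡ-≡ v _ _ {{ℤ.≢-nonZero v≢0}} (begin
          v * (z * S)            ≡⟨ lemma₁ v z S ⟩
          z * (v * S)            ≡⟨ cong (λ k → z * (v * ∑< k (F m))) (ℕ.*-comm (suc m) r) ⟩
          z * (v * ∑< (r ℕ.* suc m) (F m)) ≡⟨ cong (z *_) (prefix r ℕ.≤-refl) ⟩
          z * (C r m - C 0 m)    ≡⟨ lemma₂ z (C r m) (C 0 m) ⟩
          z * C r m - z * C 0 m  ≡⟨ cong (_- z * C 0 m) (zC-r m) ⟩
          C 0 m - z * C 0 m      ≡⟨ lemma₃ z (C 0 m) ⟩
          v * C 0 m              ∎)
          where
          S = ∑< (suc m ℕ.* r) (F m)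
          lemma₁ : ∀ v z s → v * (z * s) ≡ z * (v * s)
          lemma₁ = solve-∀
          lemma₂ : ∀ z a b → z * (a - b) ≡ z * a - z * b
          lemma₂ = solve-∀
          lemma₃ : ∀ z a → a - z * a ≡ (1ℤ - z) * a
          lemma₃ = solve-∀

        rescale-< : ∀ e e′ → e ℕ.* suc (suc m) ℕ.< e′ ℕ.* suc m →
                    e ℕ.* (suc (suc m) ℕ.* r) ℕ.< e′ ℕ.* (suc m ℕ.* r)
        rescale-< e e′ lt = subst₂ ℕ._<_ (ℕ.*-assoc e _ r) (ℕ.*-assoc e′ _ r) (ℕ.*-monoˡ-< r lt)

        rescale-> : ∀ e e′ → e′ ℕ.* suc m ℕ.< e ℕ.* suc (suc m) →
                    e′ ℕ.* (suc m ℕ.* r) ℕ.< e ℕ.* (suc (suc m) ℕ.* r)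
        rescale-> e e′ lt = subst₂ ℕ._<_ (ℕ.*-assoc e′ _ r) (ℕ.*-assoc e _ r) (ℕ.*-monoˡ-< r lt)

        rescale-≡ : ∀ e e′ → e ℕ.* suc (suc m) ≡ e′ ℕ.* suc m →
                    e ℕ.* (suc (suc m) ℕ.* r) ≡ e′ ℕ.* (suc m ℕ.* r)
        rescale-≡ e e′ eq = subst₂ _≡_ (ℕ.*-assoc e _ r) (ℕ.*-assoc e′ _ r) (cong (ℕ._* r) eq)

        F≡H-suc : F≡H (suc m)
        F≡H-suc q q<r = begin
          ∑< (suc m ℕ.* r) (λ e → κ e * F m e)
            ≡⟨ cong (λ k → ∑< k (λ e → κ e * F m e)) τ≡ ⟩
          ∑< (T ℕ.+ suc N) (λ e → κ e * F m e)
            ≡⟨ ∑<-threshold-skip T N κ (F m) below at above ⟩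
          v * ∑< T (F m) + z * ∑< (T ℕ.+ suc N) (F m) - z * F m T
            ≡⟨ cong (λ k → v * ∑< T (F m) + z * ∑< k (F m) - z * F m T) τ≡ ⟨
          v * ∑< T (F m) + z * ∑< (suc m ℕ.* r) (F m) - z * F m T
            ≡⟨ cong₂ (λ x y → x - z * y) (cong₂ _+_ (prefix q (ℕ.<⇒≤ q<r)) total) (F≡Hₘ q q<r) ⟩
          C q m - C 0 m + C 0 m - z * H q m
            ≡⟨ lemma (C q m) (C 0 m) (z * H q m) ⟩
          C q m - z * H q m
            ≡⟨ C-zH q m ⟩
          H q (suc m) ∎
          where
          -- Before the common factor `r` is divided out, `T` and `e′` both give the fraction
          -- `q / r`; hence `T` is the only plateau.
          T  = q ℕ.* suc m
          e′ = q ℕ.* suc (suc m)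
          κ  = λ e → kernel (suc m ℕ.* r) e (suc (suc m) ℕ.* r) e′
          N  = suc m ℕ.* r ℕ.∸ suc T
          T<τ : T ℕ.< suc m ℕ.* r
          T<τ = subst (T ℕ.<_) (ℕ.*-comm r (suc m)) (ℕ.*-monoˡ-< (suc m) q<r)
          τ≡ : suc m ℕ.* r ≡ T ℕ.+ suc N
          τ≡ = trans (sym (ℕ.m+[n∸m]≡n T<τ)) (sym (ℕ.+-suc T N))
          Tm≡ : T ℕ.* suc (suc m) ≡ e′ ℕ.* suc m
          Tm≡ = comm q (suc m) (suc (suc m))
            where
            comm : ∀ a b c → a ℕ.* b ℕ.* c ≡ a ℕ.* c ℕ.* b
            comm = ℕ.solve-∀
          below : ∀ e → e ℕ.< T → κ e ≡ 1ℤ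
          below e e<T = kernel-< (suc m ℕ.* r) e _ e′ (rescale-< e e′
            (subst (e ℕ.* suc (suc m) ℕ.<_) Tm≡ (ℕ.*-monoˡ-< (suc (suc m)) e<T)))
          at : κ T ≡ 0ℤ
          at = kernel-≡ (suc m ℕ.* r) T _ e′ (rescale-≡ T e′ Tm≡)
          above : ∀ e → T ℕ.< e → κ e ≡ z
          above e T<e = kernel-> (suc m ℕ.* r) e _ e′ (rescale-> e e′
            (subst (ℕ._< e ℕ.* suc (suc m)) Tm≡ (ℕ.*-monoˡ-< (suc (suc m)) T<e)))
          lemma : ∀ a b c → a - b + b - c ≡ a - c
          lemma = solve-∀

        F≡G-suc : F≡G (suc m)
        F≡G-suc q a b q<r a+b≡m = begin
          ∑< (suc m ℕ.* r) (λ e → κ e * F m e)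
            ≡⟨ cong (λ k → ∑< k (λ e → κ e * F m e)) τ≡ ⟩
          ∑< (T ℕ.+ N) (λ e → κ e * F m e)
            ≡⟨ ∑<-threshold T N κ (F m) below above ⟩
          v * ∑< T (F m) + z * ∑< (T ℕ.+ N) (F m)
            ≡⟨ cong₂ (λ x k → v * x + z * ∑< k (F m)) (∑<-+ T₀ (suc b) (F m)) (sym τ≡) ⟩
          v * (∑< T₀ (F m) + ∑< (suc b) (λ p → F m (T₀ ℕ.+ p))) + z * ∑< (suc m ℕ.* r) (F m)
            ≡⟨ cong₂ _+_ (ℤ.*-distribˡ-+ v (∑< T₀ (F m)) _) total ⟩
          v * ∑< T₀ (F m) + v * ∑< (suc b) (λ p → F m (T₀ ℕ.+ p)) + C 0 m
            ≡⟨ cong₂ (λ x y → x + y + C 0 m) (prefix q (ℕ.<⇒≤ q<r))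
                 (block q a b q<r (ℕ.suc-injective a+b≡m)) ⟩
          C q m - C 0 m + (G q a b - C q m) + C 0 m
            ≡⟨ lemma (C q m) (C 0 m) (G q a b) ⟩
          G q a b ∎
          where
          T₀ = q ℕ.* suc m
          -- Ascents into `e′` start exactly at the `e` below `T`: the cross products differ by
          -- `m + 1 - b > 0` at `e = T - 1` and by `b + 1` in the other direction at `e = T`. There
          -- is no plateau.
          T  = T₀ ℕ.+ suc b
          e′ = q ℕ.* suc (suc m) ℕ.+ suc b
          κ  = λ e → kernel (suc m ℕ.* r) e (suc (suc m) ℕ.* r) e′
          N  = suc m ℕ.* r ℕ.∸ T
          b≤m : b ℕ.≤ m
          b≤m = subst (b ℕ.≤_) (ℕ.suc-injective a+b≡m) (ℕ.m≤n+m b a)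
          T≤τ : T ℕ.≤ suc m ℕ.* r
          T≤τ = ℕ.≤-trans (ℕ.+-monoʳ-≤ T₀ (s≤s b≤m))
            (subst₂ ℕ._≤_ (ℕ.+-comm (suc m) T₀) (ℕ.*-comm r (suc m)) (ℕ.*-monoˡ-≤ (suc m) q<r))
          τ≡ : suc m ℕ.* r ≡ T ℕ.+ N
          τ≡ = sym (ℕ.m+[n∸m]≡n T≤τ)
          below : ∀ e → e ℕ.< T → κ e ≡ 1ℤ
          below e e<T = kernel-< (suc m ℕ.* r) e _ e′ (rescale-< e e′ (ℕ.≤-<-trans
            (ℕ.*-monoˡ-≤ (suc (suc m)) (ℕ.s≤s⁻¹ (subst (e ℕ.<_) (ℕ.+-suc T₀ b) e<T)))
            (subst₂ ℕ._<_ (eq₁ q b m) (eq₂ q b m)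
              (ℕ.+-monoʳ-< (q ℕ.* suc m ℕ.* suc (suc m) ℕ.+ b ℕ.* suc m) (s≤s b≤m)))))
            where
            eq₁ : ∀ q b m → q ℕ.* suc m ℕ.* suc (suc m) ℕ.+ b ℕ.* suc m ℕ.+ b ≡
                            (q ℕ.* suc m ℕ.+ b) ℕ.* suc (suc m)
            eq₁ = ℕ.solve-∀
            eq₂ : ∀ q b m → q ℕ.* suc m ℕ.* suc (suc m) ℕ.+ b ℕ.* suc m ℕ.+ suc m ≡
                            (q ℕ.* suc (suc m) ℕ.+ suc b) ℕ.* suc m
            eq₂ = ℕ.solve-∀
          above : ∀ e → T ℕ.≤ e → κ e ≡ z
          above e T≤e = kernel-> (suc m ℕ.* r) e _ e′ (rescale-> e e′ (ℕ.<-≤-trans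
            (subst (e′ ℕ.* suc m ℕ.<_) (eq q b m) (ℕ.m<m+n (e′ ℕ.* suc m) (s≤s z≤n)))
            (ℕ.*-monoˡ-≤ (suc (suc m)) T≤e)))
            where
            eq : ∀ q b m → (q ℕ.* suc (suc m) ℕ.+ suc b) ℕ.* suc m ℕ.+ suc b ≡
                           (q ℕ.* suc m ℕ.+ suc b) ℕ.* suc (suc m)
            eq = ℕ.solve-∀
          lemma : ∀ a b c → a - b + (c - a) + b ≡ c
          lemma = solve-∀

      -- Both closed forms are proved together, because a block contains one value of the first kind
      -- and `m` of the second. For `m = 0` the second kind is empty.
      F-closed : ∀ m → F≡H m × F≡G m
      F-closed zero    = (λ _ _ → sym d-zero) , λ _ _ _ _ ()
      F-closed (suc m) = F≡H-suc , F≡G-suc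
        where open Prefix m (proj₁ (F-closed m)) (proj₂ (F-closed m))

      -- Only `e = 0` is lost at the final step, so `total` minus that term leaves
      -- `d ((t + z) tᵐ) - z d (tᵐ)`.
      ∑F-final : ∀ m → ∑< (suc m ℕ.* r) (λ e → F m e * final e) ≡ d (suc m)
      ∑F-final m = begin
        ∑< (suc m ℕ.* r) (λ e → F m e * final e)
          ≡⟨ split (suc m ℕ.* r) (F m) {{ℕ.m*n≢0 (suc m) r}} ⟩
        z * ∑< (suc m ℕ.* r) (F m) - z * F m 0
          ≡⟨ cong₂ (λ x y → x - z * y) total (proj₁ (F-closed m) 0 (ℕ.>-nonZero⁻¹ r)) ⟩
        C 0 m - z * H 0 m
          ≡⟨ C-zH 0 m ⟩
        H 0 (suc m)
          ≡⟨ H-0 (suc m) ⟩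
        d (suc m) ∎
        where
        open Prefix m (proj₁ (F-closed m)) (proj₂ (F-closed m)) using (total)
        split : ∀ N (f : ℕ → ℤ) .{{_ : NonZero N}} →
                ∑< N (λ e → f e * final e) ≡ z * ∑< N f - z * f 0
        split (suc N) f = begin
          f 0 * 0ℤ + ∑< N (λ e → f (suc e) * z)
            ≡⟨ cong (λ x → f 0 * 0ℤ + x) (trans
                 (∑<-cong N (λ e _ → ℤ.*-comm (f (suc e)) z)) (sym (*-distribˡ-∑< z N (f ∘ suc)))) ⟩
          f 0 * 0ℤ + z * ∑< N (f ∘ suc)
            ≡⟨ lemma z (f 0) (∑< N (f ∘ suc)) ⟩
          z * (f 0 + ∑< N (f ∘ suc)) - z * f 0 ∎
          where
          lemma : ∀ z a b → a * 0ℤ + z * b ≡ z * (a + b) - z * a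
          lemma = solve-∀

-- Generating polynomials

eval : ℕ → Poly → ℕ
eval z []      = 0
eval z (a ∷ p) = a ℕ.+ z ℕ.* eval z p

eval-+ₚ : ∀ z p q → eval z (p +ₚ q) ≡ eval z p ℕ.+ eval z q
eval-+ₚ z []      q       = refl
eval-+ₚ z (a ∷ p) []      = sym (ℕ.+-identityʳ _)
eval-+ₚ z (a ∷ p) (b ∷ q) = trans
  (cong (λ x → a ℕ.+ b ℕ.+ z ℕ.* x) (eval-+ₚ z p q))
  (lemma a b z (eval z p) (eval z q))
  where
  lemma : ∀ a b z x y → a ℕ.+ b ℕ.+ z ℕ.* (x ℕ.+ y) ≡ a ℕ.+ z ℕ.* x ℕ.+ (b ℕ.+ z ℕ.* y)
  lemma = ℕ.solve-∀

eval-z^ : ∀ z k → eval z (z^ k) ≡ z ℕ.^ k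
eval-z^ z zero    = cong suc (ℕ.*-zeroʳ z)
eval-z^ z (suc k) = cong (z ℕ.*_) (eval-z^ z k)

eval-uncons : ∀ z p → eval z p ≡ coeff p 0 ℕ.+ z ℕ.* eval z (List.drop 1 p)
eval-uncons z []      = sym (ℕ.*-zeroʳ z)
eval-uncons z (a ∷ p) = refl

coeff-suc : ∀ p k → coeff p (suc k) ≡ coeff (List.drop 1 p) k
coeff-suc []      k = refl
coeff-suc (a ∷ p) k = refl

-- In a base exceeding both constant terms, these are the last digits.
eval-injective : ∀ p q → (∀ z → eval (2 ℕ.+ z) p ≡ eval (2 ℕ.+ z) q) → p ≋ q
eval-injective p q p≡q = go
  where
  uncons : ∀ z → coeff p 0 ℕ.+ (2 ℕ.+ z) ℕ.* eval (2 ℕ.+ z) (List.drop 1 p) ≡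
                 coeff q 0 ℕ.+ (2 ℕ.+ z) ℕ.* eval (2 ℕ.+ z) (List.drop 1 q)
  uncons z = trans (sym (eval-uncons (2 ℕ.+ z) p)) (trans (p≡q z) (eval-uncons (2 ℕ.+ z) q))

  digit : ∀ {a} z x → a ℕ.≤ z → (a ℕ.+ (2 ℕ.+ z) ℕ.* x) ℕ.% (2 ℕ.+ z) ≡ a
  digit {a} z x a≤z = begin
    (a ℕ.+ (2 ℕ.+ z) ℕ.* x) ℕ.% (2 ℕ.+ z)
      ≡⟨ cong (λ y → (a ℕ.+ y) ℕ.% (2 ℕ.+ z)) (ℕ.*-comm (2 ℕ.+ z) x) ⟩
    (a ℕ.+ x ℕ.* (2 ℕ.+ z)) ℕ.% (2 ℕ.+ z)
      ≡⟨ ℕ.[m+kn]%n≡m%n a x (2 ℕ.+ z) ⟩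
    a ℕ.% (2 ℕ.+ z)
      ≡⟨ ℕ.m<n⇒m%n≡m (ℕ.m<n⇒m<1+n (s≤s a≤z)) ⟩
    a ∎

  head≡ : coeff p 0 ≡ coeff q 0
  head≡ = begin
    coeff p 0
      ≡⟨ digit z (eval (2 ℕ.+ z) (List.drop 1 p)) (ℕ.m≤m+n (coeff p 0) (coeff q 0)) ⟨
    (coeff p 0 ℕ.+ (2 ℕ.+ z) ℕ.* eval (2 ℕ.+ z) (List.drop 1 p)) ℕ.% (2 ℕ.+ z)
      ≡⟨ cong (ℕ._% (2 ℕ.+ z)) (uncons z) ⟩
    (coeff q 0 ℕ.+ (2 ℕ.+ z) ℕ.* eval (2 ℕ.+ z) (List.drop 1 q)) ℕ.% (2 ℕ.+ z)
      ≡⟨ digit z (eval (2 ℕ.+ z) (List.drop 1 q)) (ℕ.m≤n+m (coeff q 0) (coeff p 0)) ⟩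
    coeff q 0 ∎
    where z = coeff p 0 ℕ.+ coeff q 0

  tail≡ : ∀ z → eval (2 ℕ.+ z) (List.drop 1 p) ≡ eval (2 ℕ.+ z) (List.drop 1 q)
  tail≡ z = ℕ.*-cancelˡ-≡ _ _ (2 ℕ.+ z) (ℕ.+-cancelˡ-≡ (coeff p 0) _ _
    (trans (uncons z) (cong (ℕ._+ _) (sym head≡))))

  go : p ≋ q
  go zero    = head≡
  go (suc k) = trans (coeff-suc p k)
    (trans (eval-injective (List.drop 1 p) (List.drop 1 q) tail≡ k) (sym (coeff-suc q k)))

-- Sums over lists and enumerations

∑L : ∀ {A : Set} → (A → ℤ) → List A → ℤ
∑L f []       = 0ℤ
∑L f (x ∷ xs) = f x + ∑L f xs

∑L-cong : ∀ {A : Set} {f g : A → ℤ} → (∀ x → f x ≡ g x) → ∀ xs → ∑L f xs ≡ ∑L g xs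
∑L-cong f≗g []       = refl
∑L-cong f≗g (x ∷ xs) = cong₂ _+_ (f≗g x) (∑L-cong f≗g xs)

∑L-++ : ∀ {A : Set} (f : A → ℤ) xs ys → ∑L f (xs ++ ys) ≡ ∑L f xs + ∑L f ys
∑L-++ f []       ys = sym (ℤ.+-identityˡ _)
∑L-++ f (x ∷ xs) ys = trans (cong (λ s → f x + s) (∑L-++ f xs ys)) (sym (ℤ.+-assoc (f x) _ _))

∑L-map : ∀ {A B : Set} (f : B → ℤ) (g : A → B) xs → ∑L f (List.map g xs) ≡ ∑L (f ∘ g) xs
∑L-map f g []       = refl
∑L-map f g (x ∷ xs) = cong (λ s → f (g x) + s) (∑L-map f g xs)

∑L-concatMap : ∀ {A B : Set} (f : B → ℤ) (g : A → List B) xs →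
               ∑L f (List.concatMap g xs) ≡ ∑L (∑L f ∘ g) xs
∑L-concatMap f g []       = refl
∑L-concatMap f g (x ∷ xs) = trans (∑L-++ f (g x) _) (cong (λ s → ∑L f (g x) + s) (∑L-concatMap f g xs))

*-distribˡ-∑L : ∀ {A : Set} c (f : A → ℤ) xs → c * ∑L f xs ≡ ∑L (λ x → c * f x) xs
*-distribˡ-∑L c f []       = ℤ.*-zeroʳ c
*-distribˡ-∑L c f (x ∷ xs) = trans (ℤ.*-distribˡ-+ c (f x) _)
  (cong (λ s → c * f x + s) (*-distribˡ-∑L c f xs))

∑L-const : ∀ {A : Set} c (xs : List A) → ∑L (const c) xs ≡ + List.length xs * c
∑L-const c []       = refl
∑L-const c (x ∷ xs) = begin
  c + ∑L (const c) xs          ≡⟨ cong (λ s → c + s) (∑L-const c xs) ⟩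
  c + + List.length xs * c     ≡⟨ lemma c (+ List.length xs) ⟩
  (1ℤ + + List.length xs) * c  ≡⟨ cong (_* c) (ℤ.pos-+ 1 (List.length xs)) ⟨
  + suc (List.length xs) * c   ∎
  where
  lemma : ∀ c n → c + n * c ≡ (1ℤ + n) * c
  lemma = solve-∀

∑L-tabulate : ∀ {A : Set} (f : A → ℤ) {n} (g : Fin n → A) → ∑L f (List.tabulate g) ≡ ∑[ i < n ] f (g i)
∑L-tabulate f {zero}  g = refl
∑L-tabulate f {suc n} g = cong (λ s → f (g zero) + s) (∑L-tabulate f (g ∘ suc))

∑L-↭ : ∀ {A : Set} (f : A → ℤ) {xs ys} → xs ↭ ys → ∑L f xs ≡ ∑L f ys
∑L-↭ f ↭.refl          = refl
∑L-↭ f (↭.prep x p)    = cong (λ s → f x + s) (∑L-↭ f p)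
∑L-↭ f {x ∷ y ∷ xs} (↭.swap x y p) =
  trans (cong (λ s → f x + (f y + s)) (∑L-↭ f p)) (lemma (f x) (f y) _)
  where
  lemma : ∀ a b c → a + (b + c) ≡ b + (a + c)
  lemma = solve-∀
∑L-↭ f (↭.trans p q)   = trans (∑L-↭ f p) (∑L-↭ f q)

-- Duplicate-free lists with the same members are permutations of each other. Thus the filtered
-- lists that define the polynomials can be replaced by recursively built ones.
∑L-enumeration : ∀ {A : Set} {P : Pred A 0ℓ} (E E′ : Enumeration P) (f : A → ℤ) →
                 ∑L f (elements E) ≡ ∑L f (elements E′)
∑L-enumeration E E′ f = ∑L-↭ f (∼bag⇒↭ (unique∧set⇒bag (unique E) (unique E′)
  (mk⇔ (complete E′ ∘ sound E) (complete E ∘ sound E′))))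

pos-^ : ∀ z k → + (z ℕ.^ k) ≡ (+ z) ^ k
pos-^ z zero    = refl
pos-^ z (suc k) = trans (ℤ.pos-* z (z ℕ.^ k)) (cong (+ z *_) (pos-^ z k))

eval-generatingPoly : ∀ {A : Set} {P : Pred A 0ℓ} z (w : A → ℕ) (E E′ : Enumeration P) →
  + eval z (generatingPoly w E) ≡ ∑L (λ x → (+ z) ^ w x) (elements E′)
eval-generatingPoly z w E E′ = trans (go (elements E)) (∑L-enumeration E E′ _)
  where
  go : ∀ xs → + eval z (List.foldr _+ₚ_ [] (List.map (λ x → z^ (w x)) xs)) ≡ ∑L (λ x → (+ z) ^ w x) xs
  go []       = refl
  go (x ∷ xs) = begin
    + eval z (z^ (w x) +ₚ p)           ≡⟨ cong +_ (eval-+ₚ z (z^ (w x)) p) ⟩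
    + (eval z (z^ (w x)) ℕ.+ eval z p) ≡⟨ ℤ.pos-+ (eval z (z^ (w x))) (eval z p) ⟩
    + eval z (z^ (w x)) + + eval z p
      ≡⟨ cong₂ _+_ (trans (cong +_ (eval-z^ z (w x))) (pos-^ z (w x))) (go xs) ⟩
    (+ z) ^ w x + ∑L (λ x → (+ z) ^ w x) xs ∎
    where p = List.foldr _+ₚ_ [] (List.map (λ x → z^ (w x)) xs)

∈-concatMap-intro : ∀ {A B : Set} (f : A → List B) {xs x y} →
                    x ∈ xs → y ∈ f x → y ∈ List.concatMap f xs
∈-concatMap-intro f x∈xs y∈fx = ∈-concatMap⁺ f (lose x∈xs y∈fx)

∈-concatMap-elim : ∀ {A B : Set} (f : A → List B) {xs y} →
                   y ∈ List.concatMap f xs → ∃ λ x → x ∈ xs × y ∈ f x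
∈-concatMap-elim f y∈ = find (∈-concatMap⁻ f y∈)

-- `key` recovers from an element the `x` whose list contains it, so the lists of distinct `x` are
-- disjoint.
concatMap-unique : ∀ {A B : Set} (f : A → List B) (key : B → A) {xs} →
  (∀ {x y} → x ∈ xs → y ∈ f x → key y ≡ x) → (∀ x → Unique (f x)) →
  Unique xs → Unique (List.concatMap f xs)
concatMap-unique f key {[]}     key≡ f! []         = []
concatMap-unique f key {x ∷ xs} key≡ f! (x∉ ∷ xs!) = Unique.++⁺ (f! x)
  (concatMap-unique f key (key≡ ∘ there) f! xs!)
  λ (y∈fx , y∈) → let x′ , x′∈xs , y∈fx′ = ∈-concatMap-elim f {xs} y∈ in
    All.lookup x∉ x′∈xs (trans (sym (key≡ (here refl) y∈fx)) (key≡ (there x′∈xs) y∈fx′))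

-- Permutations and the permanent as a sum over them

insert : ∀ {n} → Fin (suc n) → Vec (Fin n) n → Vec (Fin (suc n)) (suc n)
insert p π = p ∷ Vec.map (punchIn p) π

-- Grouping by the first value follows the expansion in the definition of `per`.
permutations : ∀ n → List (Vec (Fin n) n)
permutations zero    = [] ∷ []
permutations (suc n) =
  List.concatMap (λ p → List.map (insert p) (permutations n)) (List.allFin (suc n))

∈-permutations⁻ : ∀ {n} {π : Vec (Fin n) n} → π ∈ permutations n → Bijective _≡_ _≡_ (lookup π)
∈-permutations⁻ {n} {π} π∈ =
  (λ {x} {y} → injective n π π∈ x y) ,
  λ y → let x , eq = surjective n π π∈ y in x , λ { refl → eq }
  where
  injective : ∀ n (π : Vec (Fin n) n) → π ∈ permutations n → ∀ x y → lookup π x ≡ lookup π y → x ≡ y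
  injective (suc n) π π∈ x y eq with ∈-concatMap-elim _ {List.allFin (suc n)} π∈
  ... | p , _ , π∈p with ∈-map⁻ _ π∈p
  ... | π′ , π′∈ , refl = go x y eq
    where
    go : ∀ x y → lookup (insert p π′) x ≡ lookup (insert p π′) y → x ≡ y
    go zero    zero    eq = refl
    go zero    (suc y) eq = contradiction (sym (trans eq (Vec.lookup-map y _ π′))) (Fin.punchInᵢ≢i p _)
    go (suc x) zero    eq = contradiction (trans (sym (Vec.lookup-map x _ π′)) eq) (Fin.punchInᵢ≢i p _)
    go (suc x) (suc y) eq = cong suc (injective n π′ π′∈ x y (Fin.punchIn-injective p _ _
      (trans (sym (Vec.lookup-map x _ π′)) (trans eq (Vec.lookup-map y _ π′)))))

  surjective : ∀ n (π : Vec (Fin n) n) → π ∈ permutations n → ∀ y → ∃ λ x → lookup π x ≡ y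
  surjective (suc n) π π∈ y with ∈-concatMap-elim _ {List.allFin (suc n)} π∈
  ... | p , _ , π∈p with ∈-map⁻ _ π∈p
  ... | π′ , π′∈ , refl with p Fin.≟ y
  ... | yes p≡y = zero , p≡y
  ... | no  p≢y = let x , eq = surjective n π′ π′∈ (punchOut p≢y) in
    suc x , trans (Vec.lookup-map x _ π′) (trans (cong (punchIn p) eq) (Fin.punchIn-punchOut p≢y))

∈-permutations⁺ : ∀ {n} (π : Vec (Fin n) n) → Injective _≡_ _≡_ (lookup π) → π ∈ permutations n
∈-permutations⁺ []       inj = here refl
∈-permutations⁺ (p ∷ π) inj = ∈-concatMap-intro _ (∈-allFin p)
  (subst (λ π → p ∷ π ∈ List.map (insert p) (permutations _)) map≡
    (∈-map⁺ _ (∈-permutations⁺ π′ inj′)))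
  where
  p≢ : ∀ i → p ≢ lookup π i
  p≢ i eq = contradiction (inj {zero} {suc i} eq) λ ()
  π′ = Vec.tabulate (λ i → punchOut (p≢ i))
  map≡ : Vec.map (punchIn p) π′ ≡ π
  map≡ = trans (sym (Vec.tabulate-∘ (punchIn p) (λ i → punchOut (p≢ i))))
    (trans (Vec.tabulate-cong (λ i → Fin.punchIn-punchOut (p≢ i))) (Vec.tabulate∘lookup π))
  inj′ : Injective _≡_ _≡_ (lookup π′)
  inj′ {x} {y} eq = Fin.suc-injective (inj {suc x} {suc y} (Fin.punchOut-injective (p≢ x) (p≢ y)
    (trans (sym (Vec.lookup∘tabulate _ x)) (trans eq (Vec.lookup∘tabulate _ y)))))

permutations-unique : ∀ n → Unique (permutations n)
permutations-unique zero    = [] ∷ []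
permutations-unique (suc n) = concatMap-unique _ Vec.head key≡
  (λ p → Unique.map⁺ (map-injective p _ _ ∘ Vec.∷-injectiveʳ) (permutations-unique n))
  (Unique.allFin⁺ (suc n))
  where
  key≡ : ∀ {p π} → p ∈ List.allFin (suc n) → π ∈ List.map (insert p) (permutations n) →
         Vec.head π ≡ p
  key≡ _ π∈ with _ , _ , refl ← ∈-map⁻ _ π∈ = refl
  map-injective : ∀ {m} p (π π′ : Vec (Fin n) m) →
                  Vec.map (punchIn p) π ≡ Vec.map (punchIn p) π′ → π ≡ π′
  map-injective p []      []        _  = refl
  map-injective p (x ∷ π) (x′ ∷ π′) eq = cong₂ _∷_
    (Fin.punchIn-injective p x x′ (Vec.∷-injectiveˡ eq))
    (map-injective p π π′ (Vec.∷-injectiveʳ eq))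

∏ : ∀ {n} → (Fin n → ℤ) → ℤ
∏ {zero}  f = 1ℤ
∏ {suc n} f = f zero * ∏ (f ∘ suc)

∏-cong : ∀ {n} {f g : Fin n → ℤ} → (∀ i → f i ≡ g i) → ∏ f ≡ ∏ g
∏-cong {zero}  f≗g = refl
∏-cong {suc n} f≗g = cong₂ _*_ (f≗g zero) (∏-cong (f≗g ∘ suc))

∑-permutations : ∀ n (M : Fin n → Fin n → ℤ) →
  ∑L (λ π → ∏ (λ i → M i (lookup π i))) (permutations n) ≡ per M
∑-permutations zero    M = refl
∑-permutations (suc n) M = begin
  ∑L f (permutations (suc n))
    ≡⟨ ∑L-concatMap f (λ p → List.map (insert p) (permutations n)) (List.allFin (suc n)) ⟩
  ∑L (λ p → ∑L f (List.map (insert p) (permutations n))) (List.allFin (suc n))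
    ≡⟨ ∑L-tabulate (λ p → ∑L f (List.map (insert p) (permutations n))) (λ p → p) ⟩
  ∑[ p < suc n ] ∑L f (List.map (insert p) (permutations n))
    ≡⟨ sum-cong-≗ (λ p → trans (∑L-map f (insert p) (permutations n)) (trans
         (∑L-cong (λ π → cong (M zero p *_)
           (∏-cong λ i → cong (M (suc i)) (Vec.lookup-map i (punchIn p) π))) (permutations n))
         (trans (sym (*-distribˡ-∑L (M zero p)
             (λ π → ∏ (λ i → M (suc i) (punchIn p (lookup π i)))) (permutations n)))
           (cong (M zero p *_) (∑-permutations n (λ i j → M (suc i) (punchIn p j))))))) ⟩
  per M ∎
  where f = λ π → ∏ (λ i → M i (lookup π i))

-- Colored derangements

-- This turns `z ^ exc σ` into a product over positions, so that the sum over colorings factorizes.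
∏-if : ∀ {A : Set} {P : Pred A 0ℓ} (P? : Decidable P) (z : ℤ) {n} (g : Fin n → A) →
  z ^ List.length (List.filter P? (List.tabulate g)) ≡ ∏ (λ i → if does (P? (g i)) then z else 1ℤ)
∏-if P? z {zero}  g = refl
∏-if P? z {suc n} g with P? (g zero)
... | yes _ = cong (z *_) (∏-if P? z (g ∘ suc))
... | no  _ = trans (∏-if P? z (g ∘ suc)) (sym (ℤ.*-identityˡ _))

∑L-cartesianProductWith : ∀ {A B C : Set} (f : C → ℤ) (h : A → B → C) (g : A → ℤ) (k : B → ℤ) →
  (∀ x y → f (h x y) ≡ g x * k y) → ∀ xs ys →
  ∑L f (List.cartesianProductWith h xs ys) ≡ ∑L g xs * ∑L k ys
∑L-cartesianProductWith f h g k f≡ []       ys = refl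
∑L-cartesianProductWith f h g k f≡ (x ∷ xs) ys = begin
  ∑L f (List.map (h x) ys ++ List.cartesianProductWith h xs ys)
    ≡⟨ ∑L-++ f (List.map (h x) ys) _ ⟩
  ∑L f (List.map (h x) ys) + ∑L f (List.cartesianProductWith h xs ys)
    ≡⟨ cong₂ _+_
         (trans (∑L-map f (h x) ys) (trans (∑L-cong (f≡ x) ys) (sym (*-distribˡ-∑L (g x) k ys))))
         (∑L-cartesianProductWith f h g k f≡ xs ys) ⟩
  g x * ∑L k ys + ∑L g xs * ∑L k ys
    ≡⟨ ℤ.*-distribʳ-+ (∑L k ys) (g x) (∑L g xs) ⟨
  (g x + ∑L g xs) * ∑L k ys ∎

∑L-allVecs : ∀ {A : Set} {m} (f : Fin m → A → ℤ) (L : Vector (List A) m) →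
  ∑L (λ v → ∏ (λ j → f j (lookup v j))) (allVecs L) ≡ ∏ (λ j → ∑L (f j) (L j))
∑L-allVecs {m = zero}  f L = refl
∑L-allVecs {m = suc m} f L = trans
  (∑L-cartesianProductWith _ _∷_ (f zero) (λ v → ∏ (λ j → f (suc j) (lookup v j)))
    (λ _ _ → refl) (L zero) (allVecs (L ∘ suc)))
  (cong (∑L (f zero) (L zero) *_) (∑L-allVecs (f ∘ suc) (L ∘ suc)))

∈-allVecs⁻ : ∀ {A : Set} {m} (L : Vector (List A) m) {v : Vec A m} →
             v ∈ allVecs L → ∀ j → lookup v j ∈ L j
∈-allVecs⁻ {m = suc m} L v∈ j with ∈-cartesianProductWith⁻ _∷_ (L zero) (allVecs (L ∘ suc)) v∈
∈-allVecs⁻ {m = suc m} L v∈ zero    | _ , _ , x∈ , _ , refl = x∈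
∈-allVecs⁻ {m = suc m} L v∈ (suc j) | _ , _ , _ , v∈′ , refl = ∈-allVecs⁻ (L ∘ suc) v∈′ j

module DerangementSum (n r : ℕ) (z : ℤ) where

  -- There are r + 1 colors.
  open Derangements z (+ suc r)

  -- The decision is an argument so that `∑-factor` can split on it directly.
  nonzeroIf : ∀ {A : Set} → Dec A → List (Fin (suc r))
  nonzeroIf (yes _) = List.map suc (List.allFin r)
  nonzeroIf (no  _) = List.allFin (suc r)

  colors : Fin n → Fin n → List (Fin (suc r))
  colors i j = nonzeroIf (j Fin.≟ i)

  colors-unique : ∀ i j → Unique (colors i j)
  colors-unique i j with j Fin.≟ i
  ... | yes _ = Unique.map⁺ Fin.suc-injective (Unique.allFin⁺ r)
  ... | no  _ = Unique.allFin⁺ (suc r)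

  ∈-colors⁺ : ∀ i j c → ¬ (j ≡ i × toℕ c ≡ 0) → c ∈ colors i j
  ∈-colors⁺ i j c ¬fixed with j Fin.≟ i
  ∈-colors⁺ i j zero    ¬fixed | yes j≡i = contradiction (j≡i , refl) ¬fixed
  ∈-colors⁺ i j (suc c) ¬fixed | yes _   = ∈-map⁺ suc (∈-allFin c)
  ∈-colors⁺ i j c       ¬fixed | no  _   = ∈-allFin c

  ∈-colors⁻ : ∀ i j {c} → c ∈ colors i j → ¬ (j ≡ i × toℕ c ≡ 0)
  ∈-colors⁻ i j c∈ (j≡i , c≡0) with j Fin.≟ i
  ... | no  j≢i = j≢i j≡i
  ... | yes _   with ∈-map⁻ suc c∈
  ...   | _ , _ , refl = contradiction c≡0 λ ()

  isExcedanceAt? : ∀ (i j : Fin n) (c : Fin (suc r)) → Dec (i Fin.< j ⊎ (j ≡ i × 0 ℕ.< toℕ c))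
  isExcedanceAt? i j c = (i Fin.<? j) ⊎-dec ((j Fin.≟ i) ×-dec (0 ℕ.<? toℕ c))

  factor : Fin n → Fin n → Fin (suc r) → ℤ
  factor i j c = if does (isExcedanceAt? i j c) then z else 1ℤ

  weight-< : ∀ {m} (i j : Fin m) → i Fin.< j → weight i j ≡ + suc r * z
  weight-< zero    (suc j) _         = refl
  weight-< (suc i) (suc j) (s≤s i<j) = weight-< i j i<j

  weight-≡ : ∀ {m} (i : Fin m) → weight i i ≡ (+ suc r - 1ℤ) * z
  weight-≡ zero    = refl
  weight-≡ (suc i) = weight-≡ i

  weight-> : ∀ {m} (i j : Fin m) → j Fin.< i → weight i j ≡ + suc r
  weight-> (suc i) zero    _         = refl
  weight-> (suc i) (suc j) (s≤s j<i) = weight-> i j j<i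

  factor-exc : ∀ (i j : Fin n) (c : Fin (suc r)) →
    i Fin.< j ⊎ (j ≡ i × 0 ℕ.< toℕ c) → factor i j c ≡ z
  factor-exc i j c p = cong (if_then z else 1ℤ) (dec-true (isExcedanceAt? i j c) p)

  factor-nonexc : ∀ (i j : Fin n) (c : Fin (suc r)) →
    ¬ (i Fin.< j ⊎ (j ≡ i × 0 ℕ.< toℕ c)) → factor i j c ≡ 1ℤ
  factor-nonexc i j c ¬p = cong (if_then z else 1ℤ) (dec-false (isExcedanceAt? i j c) ¬p)

  ∑L-allFin-const : ∀ {m} (f : Fin m → ℤ) c → (∀ i → f i ≡ c) → ∑L f (List.allFin m) ≡ + m * c
  ∑L-allFin-const {m} f c f≡c = trans (∑L-cong f≡c (List.allFin m))
    (trans (∑L-const c (List.allFin m)) (cong (λ k → + k * c) (List.length-tabulate {n = m} (λ i → i))))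

  -- At a fixed point the `r` nonzero colors are all excedances; elsewhere all `r + 1` colors are
  -- allowed and only the order of `i` and `j` counts.
  ∑-factor : ∀ i j → ∑L (factor i j) (colors i j) ≡ weight i j
  ∑-factor i j = go (j Fin.≟ i) (Fin.<-cmp i j)
    where
    go : (fixed? : Dec (j ≡ i)) → Tri (i Fin.< j) (i ≡ j) (j Fin.< i) →
         ∑L (factor i j) (nonzeroIf fixed?) ≡ weight i j
    go (yes refl) _ = begin
      ∑L (factor i i) (List.map suc (List.allFin r))
        ≡⟨ ∑L-map (factor i i) suc (List.allFin r) ⟩
      ∑L (factor i i ∘ suc) (List.allFin r)
        ≡⟨ ∑L-allFin-const (factor i i ∘ suc) z (λ c → factor-exc i i (suc c) (inj₂ (refl , s≤s z≤n))) ⟩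
      + r * z
        ≡⟨ cong (_* z) (trans (lemma (+ r)) (cong (_- 1ℤ) (sym (ℤ.pos-+ 1 r)))) ⟩
      (+ suc r - 1ℤ) * z
        ≡⟨ weight-≡ i ⟨
      weight i i ∎
      where
      lemma : ∀ a → a ≡ 1ℤ + a - 1ℤ
      lemma = solve-∀
    go (no j≢i) (tri< i<j _ _) = trans
      (∑L-allFin-const (factor i j) z (λ c → factor-exc i j c (inj₁ i<j)))
      (sym (weight-< i j i<j))
    go (no j≢i) (tri≈ _ i≡j _) = contradiction (sym i≡j) j≢i
    go (no j≢i) (tri> i≮j _ j<i) = trans
      (∑L-allFin-const (factor i j) 1ℤ (λ c → factor-nonexc i j c λ
        { (inj₁ i<j) → i≮j i<j ; (inj₂ (j≡i , _)) → j≢i j≡i }))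
      (trans (ℤ.*-identityʳ (+ suc r)) (sym (weight-> i j j<i)))

  colorings : Vec (Fin n) n → List (Vec (Fin (suc r)) n)
  colorings π = allVecs (λ i → colors i (lookup π i))

  derangementList : List (ColoredWord n (suc r))
  derangementList = List.concatMap (λ π → List.map (π ,_) (colorings π)) (permutations n)

  enumeration : Enumeration (IsDerangement {n} {suc r})
  enumeration = record
    { elements = derangementList
    ; unique   = concatMap-unique _ proj₁ key≡
        (λ π → Unique.map⁺ (cong proj₂) (allVecs-unique _ (λ i → colors-unique i (lookup π i))))
        (permutations-unique n)
    ; sound    = sound′
    ; complete = λ {(π , c)} ((inj , _) , ¬fixed) → ∈-concatMap-intro _ (∈-permutations⁺ π inj)
        (∈-map⁺ (π ,_) (∈-allVecs _ c (λ i → ∈-colors⁺ i (lookup π i) (lookup c i) (¬fixed i))))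
    }
    where
    key≡ : ∀ {π σ} → π ∈ permutations n → σ ∈ List.map (π ,_) (colorings π) → proj₁ σ ≡ π
    key≡ _ σ∈ with _ , _ , refl ← ∈-map⁻ _ σ∈ = refl
    sound′ : ∀ {σ} → σ ∈ derangementList → IsDerangement σ
    sound′ σ∈ with ∈-concatMap-elim (λ π → List.map (π ,_) (colorings π)) σ∈
    ... | π , π∈ , σ∈π with ∈-map⁻ (π ,_) σ∈π
    ... | c , c∈ , refl = ∈-permutations⁻ π∈ , λ i →
      ∈-colors⁻ i (lookup π i) (∈-allVecs⁻ (λ i → colors i (lookup π i)) c∈ i)

  -- For a fixed permutation the colors are chosen independently at each position, so the sum over
  -- colorings is a product of matrix entries.
  ∑-derangements : ∑L (λ σ → z ^ exc σ) derangementList ≡ d n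
  ∑-derangements = begin
    ∑L (λ σ → z ^ exc σ) derangementList
      ≡⟨ ∑L-concatMap (λ σ → z ^ exc σ) (λ π → List.map (π ,_) (colorings π)) (permutations n) ⟩
    ∑L (λ π → ∑L (λ σ → z ^ exc σ) (List.map (π ,_) (colorings π))) (permutations n)
      ≡⟨ ∑L-cong (λ π → trans (∑L-map (λ σ → z ^ exc σ) (π ,_) (colorings π)) (trans
           (∑L-cong (λ c → ∏-if (isExcedance? (π , c)) z (λ i → i)) (colorings π))
           (trans (∑L-allVecs (λ i → factor i (lookup π i)) (λ i → colors i (lookup π i)))
             (∏-cong (λ i → ∑-factor i (lookup π i)))))) (permutations n) ⟩
    ∑L (λ π → ∏ (λ i → weight i (lookup π i))) (permutations n)
      ≡⟨ ∑-permutations n weight ⟩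
    d n ∎

eval-derangementPoly : ∀ n r z .{{_ : NonZero r}} →
  + eval z (derangementPoly n r) ≡ Derangements.d (+ z) (+ r) n
eval-derangementPoly n (suc r) z = trans
  (eval-generatingPoly z exc (derangements n (suc r)) enumeration) ∑-derangements
  where open DerangementSum n r (+ z)

-- Lattice points of lecture hall simplices

fromℤ-+ : ∀ a b → fromℤ a ℚ.+ fromℤ b ≡ fromℤ (a + b)
fromℤ-+ a b = ℚ.toℚᵘ-injective (ℚᵘ.≃-trans (ℚ.toℚᵘ-homo-+ (fromℤ a) (fromℤ b))
  (ℚᵘ.*≡* (cong₂ (λ x y → (x + y) * 1ℤ) (ℤ.*-identityʳ a) (ℤ.*-identityʳ b))))

fromℤ-mono-< : ∀ {a b} → a ℤ.< b → fromℤ a ℚ.< fromℤ b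
fromℤ-mono-< a<b = ℚ.*<* (subst₂ ℤ._<_ (sym (ℤ.*-identityʳ _)) (sym (ℤ.*-identityʳ _)) a<b)

fromℤ-cancel-< : ∀ {a b} → fromℤ a ℚ.< fromℤ b → a ℤ.< b
fromℤ-cancel-< (ℚ.*<* a<b) = subst₂ ℤ._<_ (ℤ.*-identityʳ _) (ℤ.*-identityʳ _) a<b

-- The fractions `p = P / τ` and `q = Q / T` are given by equations without division and compared
-- through cross products.
module Fractions (τ T : ℕ) .{{_ : NonZero τ}} .{{_ : NonZero T}} (p q : ℚ) {P Q : ℤ}
                 (p≡ : fromℕ τ ℚ.* p ≡ fromℤ P) (q≡ : fromℕ T ℚ.* q ≡ fromℤ Q) where

  private
    pos-τT : ℚ.Positive (fromℤ (+ τ * + T))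
    pos-τT = subst (ℚ.Positive ∘ fromℤ) (ℤ.pos-* τ T) (pos (τ ℕ.* T) {{ℕ.m*n≢0 τ T}})
      where
      pos : ∀ n .{{_ : NonZero n}} → ℚ.Positive (fromℕ n)
      pos (suc n) = _

    p-scaled : fromℤ (+ τ * + T) ℚ.* p ≡ fromℤ (P * + T)
    p-scaled = begin
      fromℤ (+ τ * + T) ℚ.* p        ≡⟨ cong (ℚ._* p) (fromℤ-* (+ τ) (+ T)) ⟨
      fromℕ τ ℚ.* fromℕ T ℚ.* p      ≡⟨ lemma (fromℕ τ) (fromℕ T) p ⟩
      fromℕ τ ℚ.* p ℚ.* fromℕ T      ≡⟨ cong (ℚ._* fromℕ T) p≡ ⟩
      fromℤ P ℚ.* fromℕ T            ≡⟨ fromℤ-* P (+ T) ⟩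
      fromℤ (P * + T)                ∎
      where
      open ℚ.+-*-Solver
      lemma : ∀ a b c → a ℚ.* b ℚ.* c ≡ a ℚ.* c ℚ.* b
      lemma = solve 3 (λ a b c → a :* b :* c := a :* c :* b) refl

    q-scaled : fromℤ (+ τ * + T) ℚ.* q ≡ fromℤ (Q * + τ)
    q-scaled = begin
      fromℤ (+ τ * + T) ℚ.* q        ≡⟨ cong (ℚ._* q) (fromℤ-* (+ τ) (+ T)) ⟨
      fromℕ τ ℚ.* fromℕ T ℚ.* q      ≡⟨ lemma (fromℕ τ) (fromℕ T) q ⟩
      fromℕ T ℚ.* q ℚ.* fromℕ τ      ≡⟨ cong (ℚ._* fromℕ τ) q≡ ⟩
      fromℤ Q ℚ.* fromℕ τ            ≡⟨ fromℤ-* Q (+ τ) ⟩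
      fromℤ (Q * + τ)                ∎
      where
      open ℚ.+-*-Solver
      lemma : ∀ a b c → a ℚ.* b ℚ.* c ≡ b ℚ.* c ℚ.* a
      lemma = solve 3 (λ a b c → a :* b :* c := b :* c :* a) refl

  cross-< : p ℚ.< q → P * + T ℤ.< Q * + τ
  cross-< p<q = fromℤ-cancel-< (subst₂ ℚ._<_ p-scaled q-scaled
    (ℚ.*-monoʳ-<-pos (fromℤ (+ τ * + T)) {{pos-τT}} p<q))

  uncross-< : P * + T ℤ.< Q * + τ → p ℚ.< q
  uncross-< lt = ℚ.*-cancelˡ-<-nonNeg (fromℤ (+ τ * + T))
    {{ℚ.pos⇒nonNeg (fromℤ (+ τ * + T)) {{pos-τT}}}}
    (subst₂ ℚ._<_ (sym p-scaled) (sym q-scaled) (fromℤ-mono-< lt))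

OpenUnit : ℚ → Set
OpenUnit x = 0ℚ ℚ.< x × x ℚ.< 1ℚ

-- The gap `q - p` is in (0 , 1) iff `p < q < p + 1`; each inequality becomes one of integers by
-- cross multiplication.
module Gap (τ T : ℕ) .{{_ : NonZero τ}} .{{_ : NonZero T}} (p q : ℚ) {P Q : ℤ}
           (p≡ : fromℕ τ ℚ.* p ≡ fromℤ P) (q≡ : fromℕ T ℚ.* q ≡ fromℤ Q) where

  private
    p+1≡ : fromℕ τ ℚ.* (p ℚ.+ 1ℚ) ≡ fromℤ (P + + τ)
    p+1≡ = begin
      fromℕ τ ℚ.* (p ℚ.+ 1ℚ)      ≡⟨ ℚ.*-distribˡ-+ (fromℕ τ) p 1ℚ ⟩
      fromℕ τ ℚ.* p ℚ.+ fromℕ τ ℚ.* 1ℚ ≡⟨ cong₂ ℚ._+_ p≡ (ℚ.*-identityʳ (fromℕ τ)) ⟩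
      fromℤ P ℚ.+ fromℕ τ         ≡⟨ fromℤ-+ P (+ τ) ⟩
      fromℤ (P + + τ)             ∎

    open ℚ.+-*-Solver

    [q-p]+p≡q : ∀ p q → (q ℚ.- p) ℚ.+ p ≡ q
    [q-p]+p≡q = solve 2 (λ p q → (q :- p) :+ p := q) refl

    [p+1]-p≡1 : ∀ p → (p ℚ.+ 1ℚ) ℚ.- p ≡ 1ℚ
    [p+1]-p≡1 = solve 1 (λ p → (p :+ con 1ℚ) :- p := con 1ℚ) refl

  openUnit⇒cross : OpenUnit (q ℚ.- p) → P * + T ℤ.< Q * + τ × Q * + τ ℤ.< (P + + τ) * + T
  openUnit⇒cross (0<q-p , q-p<1) =
    Fractions.cross-< τ T p q p≡ q≡
      (subst₂ ℚ._<_ (ℚ.+-identityˡ p) ([q-p]+p≡q p q) (ℚ.+-monoˡ-< p 0<q-p)) ,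
    Fractions.cross-< T τ q (p ℚ.+ 1ℚ) q≡ p+1≡
      (subst₂ ℚ._<_ ([q-p]+p≡q p q) (ℚ.+-comm 1ℚ p) (ℚ.+-monoˡ-< p q-p<1))

  cross⇒openUnit : P * + T ℤ.< Q * + τ × Q * + τ ℤ.< (P + + τ) * + T → OpenUnit (q ℚ.- p)
  cross⇒openUnit (lt₁ , lt₂) =
    subst (ℚ._< q ℚ.- p) (ℚ.+-inverseʳ p)
      (ℚ.+-monoˡ-< (ℚ.- p) (Fractions.uncross-< τ T p q p≡ q≡ lt₁)) ,
    subst (q ℚ.- p ℚ.<_) ([p+1]-p≡1 p)
      (ℚ.+-monoˡ-< (ℚ.- p) (Fractions.uncross-< T τ q (p ℚ.+ 1ℚ) q≡ p+1≡ lt₂))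

*+-carry-< : ∀ {N k c u w} → w ℕ.< N → k ℕ.< c → k ℕ.* N ℕ.+ w ℕ.< c ℕ.* N ℕ.+ u
*+-carry-< {N} {k} {c} {u} {w} w<N k<c = ℕ.<-≤-trans (ℕ.+-monoʳ-< (k ℕ.* N) w<N)
  (ℕ.≤-trans (ℕ.≤-reflexive (ℕ.+-comm (k ℕ.* N) N))
    (ℕ.≤-trans (ℕ.*-monoˡ-≤ N k<c) (ℕ.m≤m+n (c ℕ.* N) u)))

-- A leading digit below `c` violates the lower bound and one above `c + 1` the upper bound,
-- whatever the remainders are.
digits-within : ∀ {N c k u w} → u ℕ.< N → w ℕ.< N →
  c ℕ.* N ℕ.+ u ℕ.< k ℕ.* N ℕ.+ w → k ℕ.* N ℕ.+ w ℕ.< suc c ℕ.* N ℕ.+ u →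
  (k ≡ c × u ℕ.< w) ⊎ (k ≡ suc c × w ℕ.< u)
digits-within {N} {c} {k} {u} {w} u<N w<N lower upper with ℕ.<-cmp k c
... | tri< k<c _ _ = contradiction lower (ℕ.<⇒≯ (*+-carry-< w<N k<c))
... | tri≈ _ refl _ = inj₁ (refl , ℕ.+-cancelˡ-< (k ℕ.* N) u w lower)
... | tri> _ _ c<k with ℕ.m≤n⇒m<n∨m≡n c<k
...   | inj₂ refl = inj₂ (refl , ℕ.+-cancelˡ-< (suc c ℕ.* N) w u upper)
...   | inj₁ 1+c<k = contradiction upper (ℕ.<⇒≯ (*+-carry-< {k = suc c} {c = k} u<N 1+c<k))

module Step (τ T : ℕ) .{{_ : NonZero τ}} .{{_ : NonZero T}} (c e : ℕ) (e<τ : e ℕ.< τ) where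

  private
    N u : ℕ
    N = τ ℕ.* T
    u = e ℕ.* T

    u<N : u ℕ.< N
    u<N = ℕ.*-monoˡ-< T e<τ

    w<N : ∀ {e′} → e′ ℕ.< T → e′ ℕ.* τ ℕ.< N
    w<N {e′} e′<T = subst (e′ ℕ.* τ ℕ.<_) (ℕ.*-comm T τ) (ℕ.*-monoˡ-< τ e′<T)

    lower≡ : ∀ c e τ T → (c ℕ.* τ ℕ.+ e) ℕ.* T ≡ c ℕ.* (τ ℕ.* T) ℕ.+ e ℕ.* T
    lower≡ = ℕ.solve-∀

    middle≡ : ∀ k e′ τ T → (k ℕ.* T ℕ.+ e′) ℕ.* τ ≡ k ℕ.* (τ ℕ.* T) ℕ.+ e′ ℕ.* τ
    middle≡ = ℕ.solve-∀

    upper≡ : ∀ c e τ T → (c ℕ.* τ ℕ.+ e ℕ.+ τ) ℕ.* T ≡ suc c ℕ.* (τ ℕ.* T) ℕ.+ e ℕ.* T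
    upper≡ = ℕ.solve-∀

    lowerℤ : + (c ℕ.* τ ℕ.+ e) * + T ≡ + (c ℕ.* N ℕ.+ u)
    lowerℤ = trans (sym (ℤ.pos-* (c ℕ.* τ ℕ.+ e) T)) (cong +_ (lower≡ c e τ T))

    middleℤ : ∀ k e′ → + (k ℕ.* T ℕ.+ e′) * + τ ≡ + (k ℕ.* N ℕ.+ e′ ℕ.* τ)
    middleℤ k e′ = trans (sym (ℤ.pos-* (k ℕ.* T ℕ.+ e′) τ)) (cong +_ (middle≡ k e′ τ T))

    upperℤ : (+ (c ℕ.* τ ℕ.+ e) + + τ) * + T ≡ + (suc c ℕ.* N ℕ.+ u)
    upperℤ = trans (cong (_* + T) (sym (ℤ.pos-+ (c ℕ.* τ ℕ.+ e) τ)))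
      (trans (sym (ℤ.pos-* (c ℕ.* τ ℕ.+ e ℕ.+ τ) T)) (cong +_ (upper≡ c e τ T)))

  -- This is `c + e / τ < X / T < c + e / τ + 1` with the denominators cleared.
  Between : ℤ → Set
  Between X = + (c ℕ.* τ ℕ.+ e) * + T ℤ.< X * + τ × X * + τ ℤ.< (+ (c ℕ.* τ ℕ.+ e) + + τ) * + T

  -- An ascent keeps the integer part `c`; a descent raises it by 1.
  Digits : ℤ → ℕ → Set
  Digits X e′ = (e ℕ.* T ℕ.< e′ ℕ.* τ × X ≡ + (c ℕ.* T ℕ.+ e′)) ⊎
                (e′ ℕ.* τ ℕ.< e ℕ.* T × X ≡ + (suc c ℕ.* T ℕ.+ e′))

  private
    nonNegative : ∀ τ .{{_ : NonZero τ}} X {k} → + k ℤ.< X * + τ → ∃ λ x → X ≡ + x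
    nonNegative τ       (+ x)      _ = x , refl
    nonNegative (suc τ) ℤ.-[1+ x ] ()

  between⇒digits : ∀ X → Between X → ∃ λ e′ → e′ ℕ.< T × Digits X e′
  between⇒digits X (lower , upper)
    -- The lower bound is a natural number, which excludes a negative `X`; division by `T` then
    -- yields the digits.
    with x , refl ← nonNegative τ X (subst (ℤ._< X * + τ) lowerℤ lower)
    = e′ , e′<T , digits (digits-within u<N (w<N e′<T)
        (ℤ.drop‿+<+ (subst₂ ℤ._<_ lowerℤ xτ≡ lower))
        (ℤ.drop‿+<+ (subst₂ ℤ._<_ xτ≡ upperℤ upper)))
    where
    e′ = x ℕ.% T
    k  = x ℕ./ T
    e′<T = ℕ.m%n<n x T
    x≡ : x ≡ k ℕ.* T ℕ.+ e′
    x≡ = trans (ℕ.m≡m%n+[m/n]*n x T) (ℕ.+-comm e′ (k ℕ.* T))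
    xτ≡ : + x * + τ ≡ + (k ℕ.* N ℕ.+ e′ ℕ.* τ)
    xτ≡ = trans (cong (λ x → + x * + τ) x≡) (middleℤ k e′)
    digits : (k ≡ c × e ℕ.* T ℕ.< e′ ℕ.* τ) ⊎ (k ≡ suc c × e′ ℕ.* τ ℕ.< e ℕ.* T) → Digits (+ x) e′
    digits (inj₁ (k≡c , lt)) = inj₁ (lt , cong +_ (trans x≡ (cong (λ k → k ℕ.* T ℕ.+ e′) k≡c)))
    digits (inj₂ (k≡c , lt)) = inj₂ (lt , cong +_ (trans x≡ (cong (λ k → k ℕ.* T ℕ.+ e′) k≡c)))

  digits⇒between : ∀ {X e′} → e′ ℕ.< T → Digits X e′ → Between X
  digits⇒between {e′ = e′} e′<T (inj₁ (lt , refl)) =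
    subst₂ ℤ._<_ (sym lowerℤ) (sym (middleℤ c e′)) (ℤ.+<+ (ℕ.+-monoʳ-< (c ℕ.* N) lt)) ,
    subst₂ ℤ._<_ (sym (middleℤ c e′)) (sym upperℤ) (ℤ.+<+ (*+-carry-< (w<N e′<T) (ℕ.n<1+n c)))
  digits⇒between {e′ = e′} e′<T (inj₂ (lt , refl)) =
    subst₂ ℤ._<_ (sym lowerℤ) (sym (middleℤ (suc c) e′)) (ℤ.+<+ (*+-carry-< u<N (ℕ.n<1+n c))) ,
    subst₂ ℤ._<_ (sym (middleℤ (suc c) e′)) (sym upperℤ) (ℤ.+<+ (ℕ.+-monoʳ-< (suc c ℕ.* N) lt))

-- A lattice point xᵢ = cᵢ tᵢ + eᵢ of Π° is built from an inversion sequence e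
-- without plateaus: cᵢ counts the descents so far.
points : ∀ {k} → ℕ → ℕ → ℕ → Vector ℕ k → List (Vec ℤ k × ℤ)
branch : ∀ {k} → ℕ → ℕ → ℕ → Vector ℕ (suc k) → ℕ → List (Vec ℤ (suc k) × ℤ)
extend : ∀ {k} → ℕ → Vector ℕ (suc k) → ℕ → List (Vec ℤ (suc k) × ℤ)

-- The last gap requires `c + e / τ < h < c + 1 + e / τ`: no integer `h` exists for `e = 0`, and
-- only `h = c + 1` for `0 < e < τ`.
points {zero}  τ zero    c t = []
points {zero}  τ (suc e) c t = ([] , + suc c) ∷ []
points {suc k} τ e       c t = List.concatMap (branch τ e c t) (List.upTo (t zero))

branch τ e c t e′ =
  select (ℕ.<-cmp (e ℕ.* t zero) (e′ ℕ.* τ)) (extend c t e′) [] (extend (suc c) t e′)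

extend c t e′ =
  List.map (λ (x , h) → + (c ℕ.* t zero ℕ.+ e′) ∷ x , h) (points (t zero) e′ c (t ∘ suc))

∑L-applyUpTo : ∀ {A : Set} (f : A → ℤ) (g : ℕ → A) n → ∑L f (List.applyUpTo g n) ≡ ∑< n (f ∘ g)
∑L-applyUpTo f g zero    = refl
∑L-applyUpTo f g (suc n) = cong (λ s → f (g 0) + s) (∑L-applyUpTo f (g ∘ suc) n)

module PointSum (z : ℤ) where

  open Inversion z

  term : ∀ {k} → Vec ℤ k × ℤ → ℤ
  term (x , h) = z ^ ∣ h ∣

  -- The height is `c` plus the number of later descents, the final one included, so the descents so
  -- far contribute the factor `z ^ c`.
  ∑-points : ∀ {k} τ e c (t : Vector ℕ k) → ∑L term (points τ e c t) ≡ z ^ c * W τ e t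
  ∑-branch : ∀ {k} τ e c (t : Vector ℕ (suc k)) e′ → ∑L term (branch τ e c t e′) ≡
             z ^ c * (kernel τ e (t zero) e′ * W (t zero) e′ (t ∘ suc))
  ∑-extend : ∀ {k} c (t : Vector ℕ (suc k)) e′ →
             ∑L term (extend c t e′) ≡ z ^ c * W (t zero) e′ (t ∘ suc)

  ∑-points {zero}  τ zero    c t = sym (ℤ.*-zeroʳ (z ^ c))
  ∑-points {zero}  τ (suc e) c t = trans (ℤ.+-identityʳ (z ^ suc c)) (ℤ.*-comm z (z ^ c))
  ∑-points {suc k} τ e       c t = begin
    ∑L term (List.concatMap (branch τ e c t) (List.upTo (t zero)))
      ≡⟨ ∑L-concatMap term (branch τ e c t) (List.upTo (t zero)) ⟩
    ∑L (∑L term ∘ branch τ e c t) (List.upTo (t zero))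
      ≡⟨ ∑L-cong (∑-branch τ e c t) (List.upTo (t zero)) ⟩
    ∑L (λ e′ → z ^ c * f e′) (List.upTo (t zero))
      ≡⟨ ∑L-applyUpTo (λ e′ → z ^ c * f e′) (λ e′ → e′) (t zero) ⟩
    ∑< (t zero) (λ e′ → z ^ c * f e′)
      ≡⟨ *-distribˡ-∑< (z ^ c) (t zero) f ⟨
    z ^ c * ∑< (t zero) f ∎
    where f = λ e′ → kernel τ e (t zero) e′ * W (t zero) e′ (t ∘ suc)

  ∑-branch τ e c t e′ with ℕ.<-cmp (e ℕ.* t zero) (e′ ℕ.* τ)
  ... | tri< _ _ _ = trans (∑-extend c t e′)
    (cong (z ^ c *_) (sym (ℤ.*-identityˡ (W (t zero) e′ (t ∘ suc)))))
  ... | tri≈ _ _ _ = lemma (z ^ c) (W (t zero) e′ (t ∘ suc))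
    where
    lemma : ∀ a b → 0ℤ ≡ a * (0ℤ * b)
    lemma = solve-∀
  ... | tri> _ _ _ = trans (∑-extend (suc c) t e′) (lemma z (z ^ c) (W (t zero) e′ (t ∘ suc)))
    where
    lemma : ∀ z a b → z * a * b ≡ a * (z * b)
    lemma = solve-∀

  ∑-extend c t e′ = trans (∑L-map term _ (points (t zero) e′ c (t ∘ suc)))
    (∑-points (t zero) e′ c (t ∘ suc))

Extends : ∀ {k} → ℕ → Vector ℕ (suc k) → ℕ → Vec ℤ (suc k) × ℤ → Set
Extends c t e′ (X ∷ x , h) = X ≡ + (c ℕ.* t zero ℕ.+ e′) × (x , h) ∈ points (t zero) e′ c (t ∘ suc)

∈-branch : ∀ {k} τ e c (t : Vector ℕ (suc k)) e′ {X x h} → (X ∷ x , h) ∈ branch τ e c t e′ →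
  (e ℕ.* t zero ℕ.< e′ ℕ.* τ × Extends c t e′ (X ∷ x , h)) ⊎
  (e′ ℕ.* τ ℕ.< e ℕ.* t zero × Extends (suc c) t e′ (X ∷ x , h))
∈-branch τ e c t e′ p∈ with ℕ.<-cmp (e ℕ.* t zero) (e′ ℕ.* τ)
... | tri< lt _ _ with _ , x∈ , refl ← ∈-map⁻ _ p∈ = inj₁ (lt , refl , x∈)
... | tri> _ _ gt with _ , x∈ , refl ← ∈-map⁻ _ p∈ = inj₂ (gt , refl , x∈)

-- This is the key for `concatMap-unique`: the entry `e′` is the remainder of the first coordinate.
-- The value at bound 0 is a placeholder, since a modulus must be nonzero.
head-index : ∀ {k} → ℕ → Vec ℤ (suc k) × ℤ → ℕ
head-index zero      _           = 0
head-index T@(suc _) (X ∷ x , h) = ∣ X ∣ ℕ.% T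

head-index-digit : ∀ {k} T .{{_ : NonZero T}} c e′ {x : Vec ℤ k} {h} → e′ ℕ.< T →
                   head-index T (+ (c ℕ.* T ℕ.+ e′) ∷ x , h) ≡ e′
head-index-digit T@(suc _) c e′ e′<T = trans (cong (ℕ._% T) (ℕ.+-comm (c ℕ.* T) e′))
  (trans (ℕ.[m+kn]%n≡m%n e′ c T) (ℕ.m<n⇒m%n≡m e′<T))

points-unique : ∀ {k} τ e c (t : Vector ℕ k) → (∀ j → NonZero (t j)) → Unique (points τ e c t)
branch-unique : ∀ {k} τ e c (t : Vector ℕ (suc k)) → (∀ j → NonZero (t j)) → ∀ e′ →
                Unique (branch τ e c t e′)
extend-unique : ∀ {k} c (t : Vector ℕ (suc k)) → (∀ j → NonZero (t j)) → ∀ e′ →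
                Unique (extend c t e′)

points-unique {zero}  τ zero    c t t>0 = []
points-unique {zero}  τ (suc e) c t t>0 = [] ∷ []
points-unique {suc k} τ e       c t t>0 = concatMap-unique (branch τ e c t) (head-index (t zero)) key≡
  (branch-unique τ e c t t>0) (Unique.upTo⁺ (t zero))
  where
  key≡ : ∀ {e′ p} → e′ ∈ List.upTo (t zero) → p ∈ branch τ e c t e′ → head-index (t zero) p ≡ e′
  key≡ {e′} {_ ∷ _ , _} e′∈ p∈ with ∈-branch τ e c t e′ p∈
  ... | inj₁ (_ , refl , _) = head-index-digit (t zero) {{t>0 zero}} c e′ (∈-upTo⁻ e′∈)
  ... | inj₂ (_ , refl , _) = head-index-digit (t zero) {{t>0 zero}} (suc c) e′ (∈-upTo⁻ e′∈)

branch-unique τ e c t t>0 e′ with ℕ.<-cmp (e ℕ.* t zero) (e′ ℕ.* τ)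
... | tri< _ _ _ = extend-unique c t t>0 e′
... | tri≈ _ _ _ = []
... | tri> _ _ _ = extend-unique (suc c) t t>0 e′

extend-unique c t t>0 e′ = Unique.map⁺ (λ { refl → refl })
  (points-unique (t zero) e′ c (t ∘ suc) (t>0 ∘ suc))

-- Here `a = c + e / τ` is the preceding quotient and `y` holds the quotients of the remaining
-- coordinates; in the induction `y zero` becomes the next `a`.
points-sound : ∀ {k} τ e c .{{_ : NonZero τ}} (t : Vector ℕ k) (t>0 : ∀ j → NonZero (t j)) →
  e ℕ.< τ → ∀ a x h (y : Vector ℚ k) → fromℕ τ ℚ.* a ≡ fromℕ (c ℕ.* τ ℕ.+ e) →
  (∀ j → fromℕ (t j) ℚ.* y j ≡ fromℤ (lookup x j)) →
  (x , h) ∈ points τ e c t → ∀ i → OpenUnit (gaps a y (fromℤ h) i)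
points-sound {zero} τ (suc e) c t t>0 e<τ a [] h y a≡ y≡ (here refl) zero =
  -- The height is treated as one more coordinate with bound 1 and digit 0, reached by a descent.
  Gap.cross⇒openUnit τ 1 a (fromℕ (suc c)) a≡ (ℚ.*-identityˡ (fromℕ (suc c)))
    (Step.digits⇒between τ 1 c (suc e) e<τ {e′ = 0} (s≤s z≤n)
      (inj₂ (s≤s z≤n , cong (λ x → + suc x) (sym (trans (ℕ.+-identityʳ (c ℕ.* 1)) (ℕ.*-identityʳ c))))))
points-sound {suc k} τ e c t t>0 e<τ a (X ∷ x) h y a≡ y≡ p∈ i
  with e′ , e′∈ , p∈′ ← ∈-concatMap-elim (branch τ e c t) {List.upTo (t zero)} p∈
  = go (∈-branch τ e c t e′ p∈′) i
  where
  instance _ = t>0 zero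
  e′<T = ∈-upTo⁻ e′∈
  go : (e ℕ.* t zero ℕ.< e′ ℕ.* τ × Extends c t e′ (X ∷ x , h)) ⊎
       (e′ ℕ.* τ ℕ.< e ℕ.* t zero × Extends (suc c) t e′ (X ∷ x , h)) →
       ∀ i → OpenUnit (gaps a y (fromℤ h) i)
  go (inj₁ (lt , X≡ , _)) zero =
    Gap.cross⇒openUnit τ (t zero) a (y zero) a≡ (y≡ zero)
      (Step.digits⇒between τ (t zero) c e e<τ e′<T (inj₁ (lt , X≡)))
  go (inj₂ (gt , X≡ , _)) zero =
    Gap.cross⇒openUnit τ (t zero) a (y zero) a≡ (y≡ zero)
      (Step.digits⇒between τ (t zero) c e e<τ e′<T (inj₂ (gt , X≡)))
  go (inj₁ (_ , X≡ , x∈)) (suc i) = points-sound (t zero) e′ c (t ∘ suc) (t>0 ∘ suc) e′<T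
    (y zero) x h (y ∘ suc) (trans (y≡ zero) (cong fromℤ X≡)) (y≡ ∘ suc) x∈ i
  go (inj₂ (_ , X≡ , x∈)) (suc i) = points-sound (t zero) e′ (suc c) (t ∘ suc) (t>0 ∘ suc) e′<T
    (y zero) x h (y ∘ suc) (trans (y≡ zero) (cong fromℤ X≡)) (y≡ ∘ suc) x∈ i

-- An open gap determines the next entry and the kind of step by `between⇒digits`, and the same
-- comparison selects the branch.
points-complete : ∀ {k} τ e c .{{_ : NonZero τ}} (t : Vector ℕ k) (t>0 : ∀ j → NonZero (t j)) →
  e ℕ.< τ → ∀ a x h (y : Vector ℚ k) → fromℕ τ ℚ.* a ≡ fromℕ (c ℕ.* τ ℕ.+ e) →
  (∀ j → fromℕ (t j) ℚ.* y j ≡ fromℤ (lookup x j)) →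
  (∀ i → OpenUnit (gaps a y (fromℤ h) i)) → (x , h) ∈ points τ e c t
points-complete {zero} τ e c t t>0 e<τ a [] h y a≡ y≡ open-gaps =
  last e {e<τ} (Step.between⇒digits τ 1 c e e<τ h
    (Gap.openUnit⇒cross τ 1 a (fromℤ h) a≡ (ℚ.*-identityˡ (fromℤ h)) (open-gaps zero)))
  where
  last : ∀ e {e<τ} → (∃ λ e′ → e′ ℕ.< 1 × Step.Digits τ 1 c e e<τ h e′) →
         ([] , h) ∈ points {zero} τ e c t
  -- With bound 1 the only digit is 0: no ascent leads to it, and a descent needs `e > 0`.
  last e       (zero , _ , inj₁ (() , _))
  last (suc e) (zero , _ , inj₂ (_ , refl)) =
    here (cong (λ x → [] , + suc x) (trans (ℕ.+-identityʳ (c ℕ.* 1)) (ℕ.*-identityʳ c)))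
  last zero    (zero , _ , inj₂ (() , _))
  last e       (suc _ , s≤s () , _)
points-complete {suc k} τ e c t t>0 e<τ a (X ∷ x) h y a≡ y≡ open-gaps =
  let e′ , e′<T , digits = Step.between⇒digits τ (t zero) c e e<τ X
        (Gap.openUnit⇒cross τ (t zero) a (y zero) a≡ (y≡ zero) (open-gaps zero))
  in ∈-concatMap-intro (branch τ e c t) (∈-upTo⁺ e′<T) (in-branch e′ e′<T digits)
  where
  instance _ = t>0 zero
  rest : ∀ c e′ → e′ ℕ.< t zero → X ≡ + (c ℕ.* t zero ℕ.+ e′) → (X ∷ x , h) ∈ extend c t e′
  rest c e′ e′<T refl = ∈-map⁺ _ (points-complete (t zero) e′ c (t ∘ suc) (t>0 ∘ suc) e′<T
    (y zero) x h (y ∘ suc) (y≡ zero) (y≡ ∘ suc) (open-gaps ∘ suc))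
  in-branch : ∀ e′ → e′ ℕ.< t zero → Step.Digits τ (t zero) c e e<τ X e′ →
              (X ∷ x , h) ∈ branch τ e c t e′
  in-branch e′ e′<T digits with ℕ.<-cmp (e ℕ.* t zero) (e′ ℕ.* τ) | digits
  ... | tri< _ _ _   | inj₁ (_ , X≡)  = rest c e′ e′<T X≡
  ... | tri< _ _ ¬gt | inj₂ (gt , _)  = contradiction gt ¬gt
  ... | tri≈ ¬lt _ _ | inj₁ (lt , _)  = contradiction lt ¬lt
  ... | tri≈ _ _ ¬gt | inj₂ (gt , _)  = contradiction gt ¬gt
  ... | tri> ¬lt _ _ | inj₁ (lt , _)  = contradiction lt ¬lt
  ... | tri> _ _ _   | inj₂ (_ , X≡)  = rest (suc c) e′ e′<T X≡

-- The chain of quotients starts at 0, that is, at the entry 0 of bound 1 with integer part 0.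
eval-lectureHallPoly : ∀ {m} (t : Vector ℕ m) t>0 z →
  + eval z (lectureHallPoly t t>0) ≡ Inversion.W (+ z) 1 0 t
eval-lectureHallPoly {m} t t>0 z = trans
  (eval-generatingPoly z (∣_∣ ∘ proj₂) Π°-enumeration enumeration)
  (trans (PointSum.∑-points (+ z) 1 0 0 t) (ℤ.*-identityˡ _))
  where
  open LectureHall t t>0
  X : Vec ℤ m → Vector ℚ m
  X x = fromℤ ∘ lookup x
  y≡ : ∀ x j → fromℕ (t j) ℚ.* (X x /t) j ≡ fromℤ (lookup x j)
  y≡ x j = ÷-cancel (fromℤ (lookup x j)) (fromℕ (t j)) {{t>0 j}}
  enumeration : Enumeration (Π° isLatticeSimplex)
  enumeration = record
    { elements = points 1 0 0 t
    ; unique   = points-unique 1 0 0 t t>0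
    ; sound    = λ {(x , h)} p∈ → gaps 0ℚ (X x /t) (fromℤ h) ,
        points-sound 1 0 0 t t>0 (s≤s z≤n) 0ℚ x h (X x /t) refl (y≡ x) p∈ ,
        gaps-combination (X x) (fromℤ h)
    ; complete = λ {(x , h)} (λs , open-λs , comb) →
        points-complete 1 0 0 t t>0 (s≤s z≤n) 0ℚ x h (X x /t) refl (y≡ x)
          (λ i → subst OpenUnit (combination⇒gaps λs (X x) (fromℤ h) comb i) (open-λs i))
    }

-- The sum of both polynomials

module _ (z : ℤ) where

  open Inversion z

  kernel-zero : ∀ τ τ′ e′ .{{_ : NonZero τ}} → kernel τ 0 τ′ (suc e′) ≡ 1ℤ
  kernel-zero τ τ′ e′ = kernel-< τ 0 τ′ (suc e′) (ℕ.>-nonZero⁻¹ (suc e′ ℕ.* τ) {{ℕ.m*n≢0 (suc e′) τ}})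

  -- Since 0 / 1 and 0 / τ are the same fraction, a sequence counted for `s` can be read as one that
  -- continues `e₁ = 0`.
  W-zero : ∀ {k} τ (t : Vector ℕ k) .{{_ : NonZero τ}} → W 1 0 t ≡ W τ 0 t
  W-zero {zero}  τ t = refl
  W-zero {suc k} τ t = ∑<-cong (t zero) λ e′ _ → cong (_* W (t zero) e′ (t ∘ suc)) (kernel≡ e′)
    where
    kernel≡ : ∀ e′ → kernel 1 0 (t zero) e′ ≡ kernel τ 0 (t zero) e′
    kernel≡ zero     = trans (kernel-≡ 1 0 (t zero) 0 refl) (sym (kernel-≡ τ 0 (t zero) 0 refl))
    kernel≡ (suc e′) = trans (kernel-zero 1 (t zero) e′) (sym (kernel-zero τ (t zero) e′))

  -- The two summands are the sequences with e₁ = 0 and with e₁ > 0.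
  W-first : ∀ {k} N (t : Vector ℕ k) .{{_ : NonZero N}} →
    W 1 0 t + ∑< N (λ e → kernel 1 0 N e * W N e t) ≡ ∑< N (λ e → 1ℤ * W N e t)
  W-first N@(suc N-1) t = begin
    W 1 0 t + (kernel 1 0 N 0 * W N 0 t + ∑< N-1 (λ e → kernel 1 0 N (suc e) * W N (suc e) t))
      ≡⟨ cong₂ (λ x y → x + (y * W N 0 t + ∑< N-1 (λ e → kernel 1 0 N (suc e) * W N (suc e) t)))
           (W-zero N t) (kernel-≡ 1 0 N 0 refl) ⟩
    W N 0 t + (0ℤ * W N 0 t + ∑< N-1 (λ e → kernel 1 0 N (suc e) * W N (suc e) t))
      ≡⟨ cong (λ s → W N 0 t + (0ℤ * W N 0 t + s))
           (∑<-cong N-1 (λ e _ → cong (_* W N (suc e) t) (kernel-zero 1 N e))) ⟩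
    W N 0 t + (0ℤ * W N 0 t + ∑< N-1 (λ e → 1ℤ * W N (suc e) t))
      ≡⟨ lemma (W N 0 t) (∑< N-1 (λ e → 1ℤ * W N (suc e) t)) ⟩
    ∑< N (λ e → 1ℤ * W N e t) ∎
    where
    lemma : ∀ a b → a + (0ℤ * a + b) ≡ 1ℤ * a + b
    lemma = solve-∀

W-total : ∀ n r z .{{_ : NonZero n}} .{{_ : NonZero r}} → 1ℤ - z ≢ 0ℤ →
  Inversion.W z 1 0 (s n r) + Inversion.W z 1 0 (μ n r) ≡ Derangements.d z (+ r) n
W-total n@(suc n-1) r@(suc _) z v≢0 = begin
  W 1 0 (s n r) + W 1 0 (μ n r)
    -- The bounds `μ` are `1 * r` followed by `s`, so `W 1 0 (μ n r)` unfolds to the sum over `e₁`.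
    ≡⟨ W-first z (1 ℕ.* r) (s n r) ⟩
  ∑< (1 ℕ.* r) (λ e → F 0 e * W (1 ℕ.* r) e (s n r))
    ≡⟨ adjoint 0 (s n r) (λ _ → refl) ⟩
  ∑< (n ℕ.* r) (λ e → F n-1 e * final e)
    ≡⟨ ∑F-final n-1 ⟩
  d n ∎
  where
  open Inversion z
  open Forward r
  open Derangements z (+ r)
  open Closed d refl v≢0 d-shift

eval-+ₚ-≡ : ∀ z p q u {a b c} → + eval z p ≡ a → + eval z q ≡ b → + eval z u ≡ c →
            a + b ≡ c → eval z (p +ₚ q) ≡ eval z u
eval-+ₚ-≡ z p q u refl refl refl p+q≡u = trans (eval-+ₚ z p q) (ℤ.+-injective p+q≡u)

theorem4p9 : ∀ (n r : ℕ) .{{_ : NonZero n}} .{{_ : NonZero r}} →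
    lectureHallPoly (s n r) (s>0 n r) +ₚ lectureHallPoly (μ n r) (μ>0 n r) ≋ derangementPoly n r
theorem4p9 n r = eval-injective
  (lectureHallPoly (s n r) (s>0 n r) +ₚ lectureHallPoly (μ n r) (μ>0 n r)) (derangementPoly n r)
  λ z → eval-+ₚ-≡ (2 ℕ.+ z)
    (lectureHallPoly (s n r) (s>0 n r)) (lectureHallPoly (μ n r) (μ>0 n r)) (derangementPoly n r)
    (eval-lectureHallPoly (s n r) (s>0 n r) (2 ℕ.+ z))
    (eval-lectureHallPoly (μ n r) (μ>0 n r) (2 ℕ.+ z))
    (eval-derangementPoly n r (2 ℕ.+ z))
    -- The difference `1 - (2 + z)` computes to a negative integer, hence is nonzero.
    (W-total n r (+ (2 ℕ.+ z)) λ ())
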